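{- Let $m \in \mathbb{Z}^+$, let $s$ be drawn uniformly at random from $\mathcal{M}_m$, and let $\mathsf{\Phi}_m = \Phi(s)$. Then \[ \mathbb{E}\{\mathsf{\Phi}_m\} = m+1 \quad\text{and}\quad \mathrm{Var}\{\mathsf{\Phi}_m\} = \frac{q-1}{q}\binom{m+1}{3}. \]
   Context: $\mathbb{F}$ is a finite field with $q$ elements. $\mathcal{M}_m$ is the set of monic polynomials in $\mathbb{F}[x]$ of degree exactly $m$. For monic $s$, $\Phi(s)$ is the number of distinct monic divisors of $s$. -}

module Defs where

open import Level using (0ℓ)
open import Algebra.Bundles using (CommutativeRing)
open import Data.Bool using (Bool; true; false; _∧_)
open import Data.Product using (∃; _,_)
open import Data.Nat as ℕ using (ℕ; zero; suc; _∸_; NonZero)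
open import Data.List using (List; []; _∷_; _++_; [_]; map; length; foldr; filterᵇ; concatMap)
open import Data.List.Relation.Unary.Any using (Any; here; there)
open import Data.List.Relation.Unary.AllPairs using (AllPairs)
open import Data.Bool.ListAction using (any)
open import Data.Vec using (Vec; toList)
import Data.Vec as Vec
open import Data.Rational as ℚ using (ℚ; _/_; 0ℚ)
open import Data.Integer using (+_)
open import Relation.Nullary using (¬_; does)
open import Relation.Binary using (Decidable)

record FiniteField : Set₁ where
  field
    commRing : CommutativeRing 0ℓ 0ℓ
  open CommutativeRing commRing public
  field
    _≟_      : Decidable _≈_
    1≉0      : ¬ (1# ≈ 0#)
    inverse  : ∀ x → ¬ (x ≈ 0#) → ∃ λ y → (x * y) ≈ 1#
    elems    : List Carrier
    complete : ∀ x → Any (x ≈_) elems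
    distinct : AllPairs (λ a b → ¬ (a ≈ b)) elems

  card : ℕ
  card = length elems

card-nonZero : (F : FiniteField) → NonZero (FiniteField.card F)
card-nonZero F with FiniteField.elems F | FiniteField.complete F (FiniteField.0# F)
... | _ ∷ _ | _ = _

-- Polynomials over F, as little-endian coefficient lists

module Poly (F : FiniteField) where
  open FiniteField F using (Carrier; _+_; _*_; 0#; 1#; _≟_; elems)

  Polynomial : Set
  Polynomial = List Carrier

  infixl 6 _+ₚ_
  infixl 7 _*ₚ_

  _+ₚ_ : Polynomial → Polynomial → Polynomial
  []       +ₚ g        = g
  (a ∷ f)  +ₚ []       = a ∷ f
  (a ∷ f)  +ₚ (b ∷ g)  = (a + b) ∷ (f +ₚ g)

  _*ₚ_ : Polynomial → Polynomial → Polynomial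
  []      *ₚ g = []
  (a ∷ f) *ₚ g = map (a *_) g +ₚ (0# ∷ (f *ₚ g))

  -- coefficientwise equality test (used only on lists of equal length)
  _==_ : Polynomial → Polynomial → Bool
  []      == []      = true
  (a ∷ f) == (b ∷ g) = does (a ≟ b) ∧ (f == g)
  _       == _       = false

  -- a monic polynomial of degree exactly k is determined by its k lower
  -- coefficients c₀ … c_{k-1}:  c₀ + c₁x + … + c_{k-1}x^{k-1} + x^k
  Monic : ℕ → Set
  Monic k = Vec Carrier k

  poly : ∀ {k} → Monic k → Polynomial
  poly c = toList c ++ [ 1# ]

  allVecs : (k : ℕ) → List (Vec Carrier k)
  allVecs zero    = Vec.[] ∷ []
  allVecs (suc k) = concatMap (λ a → map (a Vec.∷_) (allVecs k)) elems

  𝓜 : (k : ℕ) → List (Monic k)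
  𝓜 = allVecs

  -- d divides s (s monic of degree m, d monic of degree k ≤ m):
  -- s = d * e for some polynomial e, necessarily monic of degree m - k
  divides? : ∀ {k m} → Monic k → Monic m → Bool
  divides? {k} {m} d s = any (λ e → (poly d *ₚ poly e) == poly s) (𝓜 (m ∸ k))

  -- Φ(s): number of distinct monic divisors of s (all have degree ≤ m)
  Φ : ∀ {m} → Monic m → ℕ
  Φ {m} s = go m
    where
    countDeg : (k : ℕ) → ℕ
    countDeg k with k ℕ.≤ᵇ m
    ... | true  = length (filterᵇ (λ d → divides? d s) (𝓜 k))
    ... | false = 0
    go : ℕ → ℕ
    go zero    = countDeg zero
    go (suc k) = countDeg (suc k) ℕ.+ go k

sumℚ : List ℚ → ℚ
sumℚ = foldr ℚ._+_ 0ℚ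

mean : List ℚ → ℚ
mean xs with length xs
... | zero  = 0ℚ
... | suc n = sumℚ xs ℚ.* ((+ 1) / suc n)

𝔼 : {A : Set} → List A → (A → ℚ) → ℚ
𝔼 xs f = mean (map f xs)

Var : {A : Set} → List A → (A → ℚ) → ℚ
Var xs f = 𝔼 xs (λ a → (f a ℚ.- μ) ℚ.* (f a ℚ.- μ))
  where μ = 𝔼 xs f

{-# OPTIONS --safe #-}
-- The moments of Φ count solutions of f e = d g in monic polynomials of degrees a, b, c, d with
-- a + b = c + d = m (for the mean e = 1), and the count is q^m + (q^m − q^(m−1)) min(a,b,c,d).
-- It is computed without unique factorization, by a descent in the manner of Euclid.  Let c be the
-- least degree.  Whether d ∣ f e depends only on f mod d, so f may be replaced by its residue, of
-- degree < c; a nonzero residue is a unit times a monic f′ of degree k < c, and the solutions of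
-- f′ e = d g are those of d g = f′ e, the same problem with the smaller least degree k.
module Submission where

open import Defs
open import Level using (0ℓ)
open import Algebra.Bundles using (CommutativeRing)
open import Data.Bool.Base using (Bool; true; false; _∧_; if_then_else_)
open import Data.Bool.ListAction using (any)
open import Data.Nat.Base as ℕ using (ℕ; zero; suc; _≤_; z≤n; s≤s)
import Data.Nat.Properties as ℕ
import Data.Rational.Properties as ℚ
open import Data.List.Base using (List; []; _∷_; _++_; map; [_]; length; concatMap; replicate; filterᵇ; downFrom)
open import Data.Product.Base using (_,_; _×_; ∃)
open import Data.Sum.Base using (inj₁; inj₂)
open import Data.Vec.Base using (Vec; []; _∷_; toList)
open import Function.Base using (_∘_)
open import Relation.Binary.Bundles using (Setoid)
open import Relation.Binary.Structures using (IsEquivalence)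
import Relation.Binary.PropositionalEquality as ≡
import Relation.Binary.Reasoning.Setoid as SetoidReasoning
open import Relation.Nullary.Decidable using (Dec; yes; no; does; does-⇔; dec-true; dec-false; map′; _×-dec_)
open import Relation.Nullary.Negation using (¬_)

-- The closed form comes from unrolling the descent. Let k be the least degree and p = q - 1. The
-- zero residue contributes q^m. By the formula for j < k, the residues of degree j contribute
-- q^(m-k) p (q^j + j p q^(j-1)), which equals q^(m-k) p ((j+1) q^j - j q^(j-1)). The sum over j < k
-- telescopes to k p q^(m-1). The binomial coefficient is the sum of min(a, m-a, c, m-c) over 0 ≤ a,
-- c ≤ m. Slicing by the value of the minimum gives nested squares, (m-1)² + (m-3)² + ..., which add
-- up to the binomial coefficient of m+1 over 3. Changes of summation variable are made by inserting
-- indicator sums and exchanging the order of summation. All counting stays in the natural numbers,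
-- with subtraction-free identities; rationals enter only at the end.

-- The polynomial ring on coefficient lists

module PolynomialRing (F : FiniteField) where
  open FiniteField F hiding (zero)
  open Poly F using (Polynomial; _+ₚ_; _*ₚ_)
  open import Algebra.Properties.CommutativeSemigroup +-commutativeSemigroup using (interchange)
  open import Algebra.Properties.Ring ring using (-0#≈0#)
  open SetoidReasoning setoid

  coef : Polynomial → ℕ → Carrier
  coef []      _       = 0#
  coef (a ∷ _) zero    = a
  coef (_ ∷ f) (suc n) = coef f n

  -- The Cauchy product of coefficient sequences. The multiplicative laws are proved for infinite
  -- sequences, where lengths and trailing zeros do not occur, and carried to lists by `coef-*`.
  conv : (ℕ → Carrier) → (ℕ → Carrier) → ℕ → Carrier
  conv f g zero    = f 0 * g 0
  conv f g (suc n) = f 0 * g (suc n) + conv (f ∘ suc) g n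

  conv-cong : ∀ {f f′ g g′} → (∀ n → f n ≈ f′ n) → (∀ n → g n ≈ g′ n) → ∀ n → conv f g n ≈ conv f′ g′ n
  conv-cong f≈ g≈ zero    = *-cong (f≈ 0) (g≈ 0)
  conv-cong f≈ g≈ (suc n) = +-cong (*-cong (f≈ 0) (g≈ (suc n))) (conv-cong (f≈ ∘ suc) g≈ n)

  conv-zeroˡ : ∀ g n → conv (λ _ → 0#) g n ≈ 0#
  conv-zeroˡ g zero    = zeroˡ _
  conv-zeroˡ g (suc n) = trans (+-cong (zeroˡ _) (conv-zeroˡ g n)) (+-identityˡ 0#)

  conv-distribʳ : ∀ h f g n → conv (λ i → f i + g i) h n ≈ conv f h n + conv g h n
  conv-distribʳ h f g zero    = distribʳ _ _ _
  conv-distribʳ h f g (suc n) = trans (+-cong (distribʳ _ _ _) (conv-distribʳ h (f ∘ suc) (g ∘ suc) n)) (interchange _ _ _ _)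

  conv-scaleˡ : ∀ a f g n → conv (λ i → a * f i) g n ≈ a * conv f g n
  conv-scaleˡ a f g zero    = *-assoc _ _ _
  conv-scaleˡ a f g (suc n) = trans (+-cong (*-assoc _ _ _) (conv-scaleˡ a (f ∘ suc) g n)) (sym (distribˡ _ _ _))

  -- Peels the opposite end of the Cauchy product. Commutativity needs it, since exchanging the
  -- factors reverses the order of summation.
  conv-last : ∀ f g n → conv f g (suc n) ≈ conv f (g ∘ suc) n + f (suc n) * g 0
  conv-last f g zero    = refl
  conv-last f g (suc n) = trans (+-congˡ (conv-last (f ∘ suc) g n)) (sym (+-assoc _ _ _))

  conv-comm : ∀ f g n → conv f g n ≈ conv g f n
  conv-comm f g zero    = *-comm _ _
  conv-comm f g (suc n) = begin
    f 0 * g (suc n) + conv (f ∘ suc) g n  ≈⟨ +-cong (*-comm _ _) (conv-comm (f ∘ suc) g n) ⟩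
    g (suc n) * f 0 + conv g (f ∘ suc) n  ≈⟨ +-comm _ _ ⟩
    conv g (f ∘ suc) n + g (suc n) * f 0  ≈⟨ conv-last g f n ⟨
    conv g f (suc n)                      ∎

  conv-assoc : ∀ f g h n → conv (conv f g) h n ≈ conv f (conv g h) n
  conv-assoc f g h zero    = *-assoc _ _ _
  conv-assoc f g h (suc n) = begin
    f 0 * g 0 * h (suc n) + conv (λ i → f 0 * g (suc i) + conv (f ∘ suc) g i) h n
      ≈⟨ +-cong (*-assoc _ _ _) (conv-distribʳ h _ _ n) ⟩
    f 0 * (g 0 * h (suc n)) + (conv (λ i → f 0 * g (suc i)) h n + conv (conv (f ∘ suc) g) h n)
      ≈⟨ +-congˡ (+-cong (conv-scaleˡ (f 0) (g ∘ suc) h n) (conv-assoc (f ∘ suc) g h n)) ⟩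
    f 0 * (g 0 * h (suc n)) + (f 0 * conv (g ∘ suc) h n + conv (f ∘ suc) (conv g h) n)
      ≈⟨ +-assoc _ _ _ ⟨
    f 0 * (g 0 * h (suc n)) + f 0 * conv (g ∘ suc) h n + conv (f ∘ suc) (conv g h) n
      ≈⟨ +-congʳ (distribˡ _ _ _) ⟨
    f 0 * conv g h (suc n) + conv (f ∘ suc) (conv g h) n ∎

  coef-+ : ∀ f g n → coef (f +ₚ g) n ≈ coef f n + coef g n
  coef-+ []      g       n       = sym (+-identityˡ _)
  coef-+ (a ∷ f) []      n       = sym (+-identityʳ _)
  coef-+ (a ∷ f) (b ∷ g) zero    = refl
  coef-+ (a ∷ f) (b ∷ g) (suc n) = coef-+ f g n

  coef-scale : ∀ a g n → coef (map (a *_) g) n ≈ a * coef g n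
  coef-scale a []      n       = sym (zeroʳ a)
  coef-scale a (b ∷ g) zero    = refl
  coef-scale a (b ∷ g) (suc n) = coef-scale a g n

  coef-* : ∀ f g n → coef (f *ₚ g) n ≈ conv (coef f) (coef g) n
  coef-* []      g n       = sym (conv-zeroˡ (coef g) n)
  coef-* (a ∷ f) g zero    = trans (coef-+ (map (a *_) g) _ 0) (trans (+-identityʳ _) (coef-scale a g 0))
  coef-* (a ∷ f) g (suc n) = trans (coef-+ (map (a *_) g) _ (suc n)) (+-cong (coef-scale a g (suc n)) (coef-* f g n))

  -ₚ_ : Polynomial → Polynomial
  -ₚ_ = map (-_)

  coef-neg : ∀ f n → coef (-ₚ f) n ≈ - coef f n
  coef-neg []      n       = sym -0#≈0#
  coef-neg (a ∷ f) zero    = refl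
  coef-neg (a ∷ f) (suc n) = coef-neg f n

  1ₚ : Polynomial
  1ₚ = [ 1# ]

  -- Equality up to trailing zero coefficients; a record, so that f and g can be inferred from f ≋ g.
  infix 4 _≋_
  record _≋_ (f g : Polynomial) : Set where
    constructor coefwise
    field at : ∀ n → coef f n ≈ coef g n
  open _≋_ public

  ≋-isEquivalence : IsEquivalence _≋_
  ≋-isEquivalence = record
    { refl  = coefwise λ _ → refl
    ; sym   = λ p → coefwise λ n → sym (at p n)
    ; trans = λ p q → coefwise λ n → trans (at p n) (at q n)
    }

  ≋-setoid : Setoid 0ℓ 0ℓ
  ≋-setoid = record { isEquivalence = ≋-isEquivalence }

  +ₚ-cong : ∀ {f f′ g g′} → f ≋ f′ → g ≋ g′ → f +ₚ g ≋ f′ +ₚ g′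
  +ₚ-cong {f} {f′} {g} {g′} p q = coefwise λ n →
    trans (coef-+ f g n) (trans (+-cong (at p n) (at q n)) (sym (coef-+ f′ g′ n)))

  *ₚ-cong : ∀ {f f′ g g′} → f ≋ f′ → g ≋ g′ → f *ₚ g ≋ f′ *ₚ g′
  *ₚ-cong {f} {f′} {g} {g′} p q = coefwise λ n →
    trans (coef-* f g n) (trans (conv-cong (at p) (at q) n) (sym (coef-* f′ g′ n)))

  *ₚ-comm : ∀ f g → f *ₚ g ≋ g *ₚ f
  *ₚ-comm f g = coefwise λ n → trans (coef-* f g n) (trans (conv-comm (coef f) (coef g) n) (sym (coef-* g f n)))

  *ₚ-assoc : ∀ f g h → (f *ₚ g) *ₚ h ≋ f *ₚ (g *ₚ h)
  *ₚ-assoc f g h = coefwise λ n → begin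
    coef (f *ₚ g *ₚ h) n                      ≈⟨ coef-* (f *ₚ g) h n ⟩
    conv (coef (f *ₚ g)) (coef h) n           ≈⟨ conv-cong (coef-* f g) (λ _ → refl) n ⟩
    conv (conv (coef f) (coef g)) (coef h) n  ≈⟨ conv-assoc (coef f) (coef g) (coef h) n ⟩
    conv (coef f) (conv (coef g) (coef h)) n  ≈⟨ conv-cong {coef f} (λ _ → refl) (coef-* g h) n ⟨
    conv (coef f) (coef (g *ₚ h)) n           ≈⟨ coef-* f (g *ₚ h) n ⟨
    coef (f *ₚ (g *ₚ h)) n                    ∎

  *ₚ-distribʳ : ∀ h f g → (f +ₚ g) *ₚ h ≋ f *ₚ h +ₚ g *ₚ h
  *ₚ-distribʳ h f g = coefwise λ n → begin
    coef ((f +ₚ g) *ₚ h) n                               ≈⟨ coef-* (f +ₚ g) h n ⟩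
    conv (coef (f +ₚ g)) (coef h) n                      ≈⟨ conv-cong (coef-+ f g) (λ _ → refl) n ⟩
    conv (λ i → coef f i + coef g i) (coef h) n          ≈⟨ conv-distribʳ (coef h) (coef f) (coef g) n ⟩
    conv (coef f) (coef h) n + conv (coef g) (coef h) n  ≈⟨ +-cong (coef-* f h n) (coef-* g h n) ⟨
    coef (f *ₚ h) n + coef (g *ₚ h) n                    ≈⟨ coef-+ (f *ₚ h) (g *ₚ h) n ⟨
    coef (f *ₚ h +ₚ g *ₚ h) n                            ∎

  *ₚ-identityˡ : ∀ f → 1ₚ *ₚ f ≋ f
  *ₚ-identityˡ f = coefwise λ where
    zero    → trans (coef-* 1ₚ f 0) (*-identityˡ _)
    (suc n) → trans (coef-* 1ₚ f (suc n)) (trans (+-cong (*-identityˡ _) (conv-zeroˡ (coef f) n)) (+-identityʳ _))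

  polynomialRing : CommutativeRing 0ℓ 0ℓ
  polynomialRing = record
    { Carrier = Polynomial ; _≈_ = _≋_ ; _+_ = _+ₚ_ ; _*_ = _*ₚ_ ; -_ = -ₚ_ ; 0# = [] ; 1# = 1ₚ
    ; isCommutativeRing = record
      { isRing = record
        { +-isAbelianGroup = record
          { isGroup = record
            { isMonoid = record
              { isSemigroup = record
                { isMagma = record { isEquivalence = ≋-isEquivalence ; ∙-cong = +ₚ-cong }
                ; assoc   = +ₚ-assoc
                }
              ; identity = comm∧idˡ⇒id +ₚ-comm (λ _ → ≋-refl)
              }
            ; inverse = comm∧invˡ⇒inv +ₚ-comm +ₚ-inverseˡ
            ; ⁻¹-cong = λ {f} {g} p → coefwise λ n → trans (coef-neg f n) (trans (-‿cong (at p n)) (sym (coef-neg g n)))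
            }
          ; comm = +ₚ-comm
          }
        ; *-cong     = *ₚ-cong
        ; *-assoc    = *ₚ-assoc
        ; *-identity = comm∧idˡ⇒id *ₚ-comm *ₚ-identityˡ
        ; distrib    = comm∧distrʳ⇒distr +ₚ-cong *ₚ-comm *ₚ-distribʳ
        }
      ; *-comm = *ₚ-comm
      }
    }
    where
    open Setoid ≋-setoid using () renaming (refl to ≋-refl)
    open import Algebra.Consequences.Setoid ≋-setoid
      using (comm∧idˡ⇒id; comm∧invˡ⇒inv; comm∧distrʳ⇒distr)
    +ₚ-assoc : ∀ f g h → (f +ₚ g) +ₚ h ≋ f +ₚ (g +ₚ h)
    +ₚ-assoc f g h = coefwise λ n → begin
      coef ((f +ₚ g) +ₚ h) n            ≈⟨ trans (coef-+ (f +ₚ g) h n) (+-congʳ (coef-+ f g n)) ⟩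
      coef f n + coef g n + coef h n    ≈⟨ +-assoc _ _ _ ⟩
      coef f n + (coef g n + coef h n)  ≈⟨ trans (coef-+ f (g +ₚ h) n) (+-congˡ (coef-+ g h n)) ⟨
      coef (f +ₚ (g +ₚ h)) n            ∎
    +ₚ-comm : ∀ f g → f +ₚ g ≋ g +ₚ f
    +ₚ-comm f g = coefwise λ n → trans (coef-+ f g n) (trans (+-comm _ _) (sym (coef-+ g f n)))
    +ₚ-inverseˡ : ∀ f → (-ₚ f) +ₚ f ≋ []
    +ₚ-inverseˡ f = coefwise λ n → trans (coef-+ (-ₚ f) f n) (trans (+-congʳ (coef-neg f n)) (-‿inverseˡ _))

-- Monic polynomials, division with remainder, decidable divisibility

module Divisibility (F : FiniteField) where
  open FiniteField F hiding (zero)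
  open Poly F using (Polynomial; _+ₚ_; _*ₚ_; Monic; poly)
  open PolynomialRing F
  open import Algebra.Properties.Ring ring using (-‿distribˡ-*)
  module P = CommutativeRing polynomialRing
  open import Algebra.Properties.Group P.+-group using (x∙y⁻¹≈ε⇒x≈y)
  open import Algebra.Properties.Ring P.ring using ([y-z]x≈yx-zx)
  open import Algebra.Properties.Semiring.Divisibility P.semiring public using (_∣_; _,_)

  -- The bound deg f < n, with zero satisfying every bound. Stated on coefficients, it is
  -- insensitive to trailing zeros of the list.
  Below : ℕ → Polynomial → Set
  Below n f = ∀ i → n ≤ i → coef f i ≈ 0#

  record IsMonic (n : ℕ) (f : Polynomial) : Set where
    constructor _,_
    field
      leading : coef f n ≈ 1#
      above   : Below (suc n) f
  open IsMonic public

  Below-resp-≋ : ∀ {n f g} → f ≋ g → Below n f → Below n g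
  Below-resp-≋ f≋g b i n≤i = trans (sym (at f≋g i)) (b i n≤i)

  IsMonic-resp-≋ : ∀ {n f g} → f ≋ g → IsMonic n f → IsMonic n g
  IsMonic-resp-≋ f≋g (l , b) = trans (sym (at f≋g _)) l , Below-resp-≋ f≋g b

  Below0⇒≋[] : ∀ {f} → Below 0 f → f ≋ []
  Below0⇒≋[] b = coefwise λ n → b n z≤n

  ≋[]⇒Below : ∀ {n f} → f ≋ [] → Below n f
  ≋[]⇒Below z i _ = at z i

  toList-Below : ∀ {n} (v : Vec Carrier n) → Below n (toList v)
  toList-Below []      i       _         = refl
  toList-Below (a ∷ v) (suc i) (s≤s n≤i) = toList-Below v i n≤i

  poly-IsMonic : ∀ {n} (v : Monic n) → IsMonic n (poly v)
  poly-IsMonic []      = refl , λ { (suc i) _ → refl }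
  poly-IsMonic (a ∷ v) = leading (poly-IsMonic v) , λ { (suc i) (s≤s n≤i) → above (poly-IsMonic v) i n≤i }

  lower : ∀ n → Polynomial → Vec Carrier n
  lower zero    f       = []
  lower (suc n) []      = 0# ∷ lower n []
  lower (suc n) (a ∷ f) = a ∷ lower n f

  toList-lower : ∀ {n f} → Below n f → toList (lower n f) ≋ f
  toList-lower {n} {f} b = coefwise (go n f b)
    where
    go : ∀ n f → Below n f → ∀ i → coef (toList (lower n f)) i ≈ coef f i
    go zero    f       b i       = sym (b i z≤n)
    go (suc n) []      b zero    = refl
    go (suc n) []      b (suc i) = go n [] (λ _ _ → refl) i
    go (suc n) (a ∷ f) b zero    = refl
    go (suc n) (a ∷ f) b (suc i) = go n f (λ j n≤j → b (suc j) (s≤s n≤j)) i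

  poly-lower : ∀ {n f} → IsMonic n f → poly (lower n f) ≋ f
  poly-lower {n} {f} m = coefwise (go n f m)
    where
    go : ∀ n f → IsMonic n f → ∀ i → coef (poly (lower n f)) i ≈ coef f i
    go zero    f       (l , b) zero    = sym l
    go zero    f       (l , b) (suc i) = sym (b (suc i) (s≤s z≤n))
    go (suc n) []      m       zero    = refl
    go (suc n) []      (l , _) (suc i) = go n [] (l , λ _ _ → refl) i
    go (suc n) (a ∷ f) m       zero    = refl
    go (suc n) (a ∷ f) (l , b) (suc i) = go n f (l , λ j n<j → b (suc j) (s≤s n<j)) i

  coef-∷-* : ∀ a f g n → coef ((a ∷ f) *ₚ g) n ≈ a * coef g n + coef (0# ∷ f *ₚ g) n
  coef-∷-* a f g n = trans (coef-+ (map (a *_) g) (0# ∷ f *ₚ g) n) (+-congʳ (coef-scale a g n))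

  module _ {c d} (d-monic : IsMonic c d) where

    open SetoidReasoning setoid

    -- In degree n + c only the coefficient of f at n meets a nonzero coefficient of d, namely the
    -- leading 1. The induction removes the constant term a of f, since a d has degree at most c.
    coef-*-monic : ∀ n f → Below (suc n) f → coef (f *ₚ d) (n ℕ.+ c) ≈ coef f n
    coef-*-monic n       []      _ = refl
    coef-*-monic zero    (a ∷ f) b = begin
      coef ((a ∷ f) *ₚ d) c                ≈⟨ coef-∷-* a f d c ⟩
      a * coef d c + coef (0# ∷ f *ₚ d) c  ≈⟨ +-cong (*-congˡ (leading d-monic)) (tail≈0 c) ⟩
      a * 1# + 0#                          ≈⟨ trans (+-identityʳ _) (*-identityʳ a) ⟩
      a                                    ∎
      where
      tail≈0 : ∀ i → coef (0# ∷ f *ₚ d) i ≈ 0#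
      tail≈0 zero    = refl
      tail≈0 (suc i) = at (P.*-congʳ {d} {f} {[]} (coefwise λ j → b (suc j) (s≤s z≤n))) i
    coef-*-monic (suc n) (a ∷ f) b = begin
      coef ((a ∷ f) *ₚ d) (suc n ℕ.+ c)                     ≈⟨ coef-∷-* a f d (suc n ℕ.+ c) ⟩
      a * coef d (suc (n ℕ.+ c)) + coef (f *ₚ d) (n ℕ.+ c)  ≈⟨ +-cong (*-congˡ (above d-monic _ (s≤s (ℕ.m≤n+m c n))))
                                                                     (coef-*-monic n f λ i n<i → b (suc i) (s≤s n<i)) ⟩
      a * 0# + coef f n  ≈⟨ trans (+-congʳ (zeroʳ a)) (+-identityˡ _) ⟩
      coef f n           ∎

    Below-tail : ∀ {n} a f → c ≤ n → Below (suc n) ((a ∷ f) *ₚ d) → Below n (f *ₚ d)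
    Below-tail a f c≤n b i n≤i = begin
      coef (f *ₚ d) i                       ≈⟨ +-identityˡ _ ⟨
      0# + coef (f *ₚ d) i                  ≈⟨ +-congʳ (trans (*-congˡ (above d-monic (suc i) (s≤s (ℕ.≤-trans c≤n n≤i)))) (zeroʳ a)) ⟨
      a * coef d (suc i) + coef (f *ₚ d) i  ≈⟨ coef-∷-* a f d (suc i) ⟨
      coef ((a ∷ f) *ₚ d) (suc i)           ≈⟨ b (suc i) (s≤s n≤i) ⟩
      0#                                    ∎

    -- `Below-tail` removes constant terms until the bound n is 0. There the tail vanishes by
    -- induction, so the coefficient of the product at c is a itself and must be 0. Cancellation and
    -- uniqueness of remainders both rest on this.
    Below-cofactor : ∀ n f → Below (n ℕ.+ c) (f *ₚ d) → Below n f
    Below-cofactor n       []      _ _       _         = refl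
    Below-cofactor (suc n) (a ∷ f) b (suc i) (s≤s n≤i) =
      Below-cofactor n f (Below-tail a f (ℕ.m≤n+m c n) b) i n≤i
    Below-cofactor zero    (a ∷ f) b i       _         = a∷f≈0 i
      where
      f≈0 : Below 0 f
      f≈0 = Below-cofactor zero f (Below-tail a f ℕ.≤-refl λ i c<i → b i (ℕ.<⇒≤ c<i))
      a∷f≈0 : ∀ i → coef (a ∷ f) i ≈ 0#
      a∷f≈0 zero    = trans (sym (coef-*-monic 0 (a ∷ f) λ { (suc i) _ → f≈0 i z≤n })) (b c ℕ.≤-refl)
      a∷f≈0 (suc i) = f≈0 i z≤n

    IsMonic-* : ∀ n {f} → IsMonic n f → IsMonic (n ℕ.+ c) (f *ₚ d)
    IsMonic-* n {f} (l , b) = trans (coef-*-monic n f b) l , below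
      where
      below : Below (suc n ℕ.+ c) (f *ₚ d)
      below i n+c<i = ≡.subst (λ j → coef (f *ₚ d) j ≈ 0#) (ℕ.m∸n+n≡m (ℕ.≤-trans (ℕ.m≤n+m c (suc n)) n+c<i))
        (trans (coef-*-monic (i ℕ.∸ c) f λ j i∸c<j → b j (ℕ.≤-trans n<i∸c (ℕ.<⇒≤ i∸c<j))) (b (i ℕ.∸ c) n<i∸c))
        where
        n<i∸c : suc n ≤ i ℕ.∸ c
        n<i∸c = ℕ.m+n≤o⇒m≤o∸n (suc n) n+c<i

    IsMonic-cofactor : ∀ n {f} → IsMonic (n ℕ.+ c) (f *ₚ d) → IsMonic n f
    IsMonic-cofactor n {f} (l , b) = trans (sym (coef-*-monic n f below)) l , below
      where below = Below-cofactor (suc n) f b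

    *ₚ-zero-cofactor : ∀ f → Below c (f *ₚ d) → f ≋ []
    *ₚ-zero-cofactor f b = Below0⇒≋[] (Below-cofactor 0 f b)

    *ₚ-cancelʳ : ∀ f g → f *ₚ d ≋ g *ₚ d → f ≋ g
    *ₚ-cancelʳ f g fd≋gd = x∙y⁻¹≈ε⇒x≈y f g (*ₚ-zero-cofactor (f P.- g) (≋[]⇒Below
      (P.trans ([y-z]x≈yx-zx d f g) (P.trans (P.+-congʳ {P.- (g *ₚ d)} fd≋gd) (P.-‿inverseʳ (g *ₚ d))))))

    -- Horner's scheme: if f = h d + v, then a + x f = (x h) d + u with u = a + x v. Since u has
    -- degree at most c, subtracting t d, where t is the coefficient of u at c, restores a remainder
    -- of degree below c.
    divide : ∀ f → ∃ λ ((h , v) : Polynomial × Vec Carrier c) → f ≋ h *ₚ d +ₚ toList v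
    divide []      = ([] , lower c []) , P.sym (toList-lower λ _ _ → refl)
    divide (a ∷ f) with divide f
    ... | (h , v) , f≋ = (t ∷ h , lower c r) , P.trans (coefwise step) (P.+-congˡ {(t ∷ h) *ₚ d} (P.sym (toList-lower r-Below)))
      where
      u : Polynomial
      u = a ∷ toList v
      t : Carrier
      t = coef u c
      r : Polynomial
      r = u +ₚ map ((- t) *_) d
      coef-r : ∀ n → coef r n ≈ coef u n + (- t) * coef d n
      coef-r n = trans (coef-+ u (map ((- t) *_) d) n) (+-congˡ (coef-scale (- t) d n))
      coef-shift : ∀ n → coef (a ∷ f) n ≈ coef (0# ∷ h *ₚ d) n + coef u n
      coef-shift zero    = sym (+-identityˡ a)
      coef-shift (suc n) = trans (at f≋ n) (coef-+ (h *ₚ d) (toList v) n)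
      r-Below : Below c r
      r-Below i c≤i with ℕ.m≤n⇒m<n∨m≡n c≤i
      r-Below (suc i) _ | inj₁ (s≤s c≤i) = begin
        coef r (suc i)                              ≈⟨ coef-r (suc i) ⟩
        coef (toList v) i + (- t) * coef d (suc i)  ≈⟨ +-cong (toList-Below v i c≤i) (*-congˡ (above d-monic (suc i) (s≤s c≤i))) ⟩
        0# + (- t) * 0#                             ≈⟨ trans (+-identityˡ _) (zeroʳ _) ⟩
        0#                                          ∎
      r-Below .c _ | inj₂ ≡.refl = begin
        coef r c              ≈⟨ coef-r c ⟩
        t + (- t) * coef d c  ≈⟨ +-congˡ (trans (*-congˡ (leading d-monic)) (*-identityʳ _)) ⟩
        t + (- t)             ≈⟨ -‿inverseʳ t ⟩
        0#                    ∎
      step : ∀ n → coef (a ∷ f) n ≈ coef ((t ∷ h) *ₚ d +ₚ r) n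
      step n = begin
        coef (a ∷ f) n                      ≈⟨ coef-shift n ⟩
        x + coef u n                        ≈⟨ +-congʳ (+-identityˡ x) ⟨
        -- Zero is written as t y - t y: the first term joins the quotient, the second the
        -- remainder.
        0# + x + coef u n                   ≈⟨ +-congʳ (+-congʳ (trans (+-congˡ (sym (-‿distribˡ-* t y))) (-‿inverseʳ (t * y)))) ⟨
        t * y + (- t) * y + x + coef u n    ≈⟨ +-congʳ (xy∙z≈xz∙y _ _ _) ⟩
        t * y + x + (- t) * y + coef u n    ≈⟨ trans (+-assoc _ _ _) (+-congˡ (+-comm _ _)) ⟩
        t * y + x + (coef u n + (- t) * y)  ≈⟨ +-cong (coef-∷-* t h d n) (coef-r n) ⟨
        coef ((t ∷ h) *ₚ d) n + coef r n    ≈⟨ coef-+ ((t ∷ h) *ₚ d) r n ⟨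
        coef ((t ∷ h) *ₚ d +ₚ r) n          ∎
        where
        open import Algebra.Properties.CommutativeSemigroup +-commutativeSemigroup using (xy∙z≈xz∙y)
        x = coef (0# ∷ h *ₚ d) n
        y = coef d n

  ∷≋[] : ∀ {a f} → a ≈ 0# → f ≋ [] → a ∷ f ≋ []
  ∷≋[] a≈0 f≋[] = coefwise λ { zero → a≈0 ; (suc n) → at f≋[] n }

  ≋[]? : ∀ f → Dec (f ≋ [])
  ≋[]? []      = yes P.refl
  ≋[]? (a ∷ f) = map′ (λ (p , q) → ∷≋[] p q) (λ p → at p 0 , coefwise (at p ∘ suc)) (a ≟ 0# ×-dec ≋[]? f)

  infix 4 _≋?_
  _≋?_ : ∀ f g → Dec (f ≋ g)
  f ≋? g = map′ (x∙y⁻¹≈ε⇒x≈y f g) (λ f≋g → P.trans (P.+-congʳ f≋g) (P.-‿inverseʳ g)) (≋[]? (f P.- g))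

  -- The remainder decides. If k d = f, the remainder equals (k - h) d and has degree below c, which
  -- forces k - h and hence the remainder to vanish.
  _∣?_ : ∀ {c} (d : Monic c) f → Dec (poly d ∣ f)
  d ∣? f with divide (poly-IsMonic d) f
  ... | (h , v) , f≋ with ≋[]? (toList v)
  ...   | yes v≋[] = yes (h , P.sym (P.trans f≋ (P.trans (P.+-congˡ {h *ₚ poly d} v≋[]) (P.+-identityʳ _))))
  ...   | no  v≉[] = no λ (k , kd≋f) → v≉[] (remainder≋[] k kd≋f)
    where
    open SetoidReasoning P.setoid
    open import Algebra.Properties.AbelianGroup P.+-abelianGroup using (xyx⁻¹≈y)
    remainder≋[] : ∀ k → k *ₚ poly d ≋ f → toList v ≋ []
    remainder≋[] k kd≋f = begin
      toList v             ≈⟨ v≋ ⟩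
      (k P.- h) *ₚ poly d  ≈⟨ P.*-congʳ {poly d} (*ₚ-zero-cofactor (poly-IsMonic d) (k P.- h) (Below-resp-≋ v≋ (toList-Below v))) ⟩
      []                   ∎
      where
      v≋ : toList v ≋ (k P.- h) *ₚ poly d
      v≋ = begin
        toList v                                   ≈⟨ xyx⁻¹≈y (h *ₚ poly d) (toList v) ⟨
        (h *ₚ poly d +ₚ toList v) P.- h *ₚ poly d  ≈⟨ P.+-congʳ {P.- (h *ₚ poly d)} (P.trans kd≋f f≋) ⟨
        (k *ₚ poly d) P.- (h *ₚ poly d)            ≈⟨ [y-z]x≈yx-zx (poly d) k h ⟨
        (k P.- h) *ₚ poly d                        ∎

-- Finite sums of natural numbers

module _ where
  open import Algebra.Properties.CommutativeSemigroup ℕ.+-commutativeSemigroup using (interchange)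
  open import Data.List.Properties using (map-++; map-cong; map-∘; ++-assoc; length-map; length-++; length-downFrom)
  open import Data.List.Relation.Unary.All as All using (All; []; _∷_)
  open import Data.List.Relation.Unary.AllPairs using (AllPairs; []; _∷_)
  open import Data.List.Relation.Unary.Any using (Any; here; there)
  open import Data.Nat.Base using (_+_; _*_; _^_; _∸_; _<_; _≤ᵇ_; _⊓_; _⊔_)
  open import Data.Nat.Combinatorics using (_C_; nC1≡n; nCk+nC[k+1]≡[n+1]C[k+1])
  open import Data.Nat.ListAction using (sum)
  open import Data.Nat.ListAction.Properties using (sum-++)
  open import Data.Nat.Properties using (+-identityʳ; +-assoc; +-comm; +-cancelʳ-≡; *-comm; *-assoc; *-distribˡ-+; *-zeroʳ; *-identityʳ; *-identityˡ)
  open import Data.Nat.Tactic.RingSolver using (solve-∀)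
  open import Data.Vec.Properties using (length-toList)
  open import Function.Bundles using (mk⇔)
  open import Relation.Binary.PropositionalEquality using (_≡_; refl; sym; trans; cong; cong₂; subst; module ≡-Reasoning)
  open ≡-Reasoning

  private variable
    A B X Y : Set

  ∑ : List A → (A → ℕ) → ℕ
  ∑ xs f = sum (map f xs)

  ∑-cong : ∀ (xs : List A) {f g} → (∀ x → f x ≡ g x) → ∑ xs f ≡ ∑ xs g
  ∑-cong xs f≗g = cong sum (map-cong f≗g xs)

  ∑-const : ∀ (xs : List A) n → ∑ xs (λ _ → n) ≡ length xs * n
  ∑-const []       n = refl
  ∑-const (x ∷ xs) n = cong (n +_) (∑-const xs n)

  ∑-zero : ∀ (xs : List A) → ∑ xs (λ _ → 0) ≡ 0
  ∑-zero xs = trans (∑-const xs 0) (*-zeroʳ (length xs))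

  ∑-distrib-+ : ∀ (xs : List A) f g → ∑ xs (λ x → f x + g x) ≡ ∑ xs f + ∑ xs g
  ∑-distrib-+ []       f g = refl
  ∑-distrib-+ (x ∷ xs) f g = trans (cong (f x + g x +_) (∑-distrib-+ xs f g)) (interchange (f x) _ _ _)

  ∑-distribˡ-* : ∀ (xs : List A) n f → ∑ xs (λ x → n * f x) ≡ n * ∑ xs f
  ∑-distribˡ-* []       n f = sym (*-zeroʳ n)
  ∑-distribˡ-* (x ∷ xs) n f = trans (cong (n * f x +_) (∑-distribˡ-* xs n f)) (sym (*-distribˡ-+ n _ _))

  ∑-distribʳ-* : ∀ (xs : List A) f n → ∑ xs (λ x → f x * n) ≡ ∑ xs f * n
  ∑-distribʳ-* xs f n = trans (∑-cong xs λ x → *-comm (f x) n) (trans (∑-distribˡ-* xs n f) (*-comm n _))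

  ∑-swap : ∀ (xs : List A) (ys : List B) (f : A → B → ℕ) → ∑ xs (λ x → ∑ ys (λ y → f x y)) ≡ ∑ ys (λ y → ∑ xs (λ x → f x y))
  ∑-swap []       ys f = sym (∑-zero ys)
  ∑-swap (x ∷ xs) ys f = trans (cong (∑ ys (f x) +_) (∑-swap xs ys f)) (sym (∑-distrib-+ ys (f x) _))

  ∑-reverse₃ : ∀ (xs : List A) (ys : List B) (zs : List X) (f : A → B → X → ℕ) →
    ∑ xs (λ x → ∑ ys λ y → ∑ zs λ z → f x y z) ≡ ∑ zs (λ z → ∑ ys λ y → ∑ xs λ x → f x y z)
  ∑-reverse₃ xs ys zs f = begin
    ∑ xs (λ x → ∑ ys λ y → ∑ zs λ z → f x y z)  ≡⟨ ∑-swap xs ys _ ⟩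
    ∑ ys (λ y → ∑ xs λ x → ∑ zs λ z → f x y z)  ≡⟨ ∑-cong ys (λ y → ∑-swap xs zs _) ⟩
    ∑ ys (λ y → ∑ zs λ z → ∑ xs λ x → f x y z)  ≡⟨ ∑-swap ys zs _ ⟩
    ∑ zs (λ z → ∑ ys λ y → ∑ xs λ x → f x y z)  ∎

  ∑-reverse₄ : ∀ (ws : List A) (xs : List B) (ys : List X) (zs : List Y) (f : A → B → X → Y → ℕ) →
    ∑ ws (λ w → ∑ xs λ x → ∑ ys λ y → ∑ zs λ z → f w x y z) ≡
    ∑ zs (λ z → ∑ ys λ y → ∑ xs λ x → ∑ ws λ w → f w x y z)
  ∑-reverse₄ ws xs ys zs f = begin
    ∑ ws (λ w → ∑ xs λ x → ∑ ys λ y → ∑ zs λ z → f w x y z)  ≡⟨ ∑-cong ws (λ w → ∑-reverse₃ xs ys zs (f w)) ⟩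
    ∑ ws (λ w → ∑ zs λ z → ∑ ys λ y → ∑ xs λ x → f w x y z)  ≡⟨ ∑-swap ws zs _ ⟩
    ∑ zs (λ z → ∑ ws λ w → ∑ ys λ y → ∑ xs λ x → f w x y z)  ≡⟨ ∑-cong zs (λ z → ∑-swap ws ys _) ⟩
    ∑ zs (λ z → ∑ ys λ y → ∑ ws λ w → ∑ xs λ x → f w x y z)  ≡⟨ ∑-cong zs (λ z → ∑-cong ys λ y → ∑-swap ws xs _) ⟩
    ∑ zs (λ z → ∑ ys λ y → ∑ xs λ x → ∑ ws λ w → f w x y z)  ∎

  ∑-concatMap-map : ∀ (xs : List A) (ys : List B) (g : A → B → X) f →
    ∑ (concatMap (λ x → map (g x) ys) xs) f ≡ ∑ xs (λ x → ∑ ys (λ y → f (g x y)))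
  ∑-concatMap-map []       ys g f = refl
  ∑-concatMap-map (x ∷ xs) ys g f = begin
    sum (map f (map (g x) ys ++ rest))             ≡⟨ cong sum (map-++ f (map (g x) ys) rest) ⟩
    sum (map f (map (g x) ys) ++ map f rest)       ≡⟨ sum-++ (map f (map (g x) ys)) _ ⟩
    sum (map f (map (g x) ys)) + sum (map f rest)  ≡⟨ cong₂ _+_ (cong sum (sym (map-∘ ys))) (∑-concatMap-map xs ys g f) ⟩
    ∑ ys (f ∘ g x) + ∑ xs (λ x → ∑ ys (f ∘ g x))   ∎
    where rest = concatMap (λ x → map (g x) ys) xs

  𝟙 : Bool → ℕ
  𝟙 b = if b then 1 else 0

  𝟙-∧ : ∀ a b → 𝟙 (a ∧ b) ≡ 𝟙 a * 𝟙 b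
  𝟙-∧ true  b = sym (*-identityˡ _)
  𝟙-∧ false b = refl

  𝟙-⇔ : ∀ {P Q : Set} (p? : Dec P) (q? : Dec Q) → (P → Q) → (Q → P) → 𝟙 (does p?) ≡ 𝟙 (does q?)
  𝟙-⇔ p? q? f g = cong 𝟙 (does-⇔ (mk⇔ f g) p? q?)

  -- Sums over the field, over coefficient vectors and over monic polynomials

  module Sums (F : FiniteField) where
    open FiniteField F using (Carrier; 0#; 1#; _≈_; _≟_; elems; complete; distinct; inverse)
      renaming (card to q)
    module K = FiniteField F
    open Poly F using (Polynomial; _+ₚ_; _*ₚ_; Monic; poly; allVecs; 𝓜)
    open PolynomialRing F
    open Divisibility F
    open import Algebra.Properties.Group P.+-group using (∙-cancelʳ)

    Respects-≈ : (Carrier → ℕ) → Set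
    Respects-≈ f = ∀ {a b} → a ≈ b → f a ≡ f b

    Respects-≋ : (Polynomial → ℕ) → Set
    Respects-≋ h = ∀ {f g} → f ≋ g → h f ≡ h g

    -- `complete` supplies an entry of `elems` equal to c and `distinct` excludes a second one. That
    -- entry may be another representative of c, so f has to respect `≈`.
    ∑-δ : ∀ c {f} → Respects-≈ f → ∑ elems (λ a → 𝟙 (does (c ≟ a)) * f a) ≡ f c
    ∑-δ c {f} f-resp = found elems (complete c) distinct
      where
      ∉⇒≉ : ∀ {x ys} → All (λ a → ¬ x ≈ a) ys → Any (c ≈_) ys → ¬ c ≈ x
      ∉⇒≉ (x≉a ∷ _)  (here c≈a)   c≈x = x≉a (K.trans (K.sym c≈x) c≈a)
      ∉⇒≉ (_ ∷ x∉ys) (there c∈ys) c≈x = ∉⇒≉ x∉ys c∈ys c≈x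
      absent : ∀ xs → All (λ a → ¬ c ≈ a) xs → ∑ xs (λ a → 𝟙 (does (c ≟ a)) * f a) ≡ 0
      absent []       []           = refl
      absent (x ∷ xs) (c≉x ∷ c∉xs) rewrite dec-false (c ≟ x) c≉x = absent xs c∉xs
      found : ∀ xs → Any (c ≈_) xs → AllPairs (λ a b → ¬ a ≈ b) xs → ∑ xs (λ a → 𝟙 (does (c ≟ a)) * f a) ≡ f c
      found (x ∷ xs) (here c≈x)   (x∉xs ∷ _) rewrite dec-true (c ≟ x) c≈x = begin
        f x + 0 + _  ≡⟨ cong₂ _+_ (+-identityʳ (f x)) (absent xs (All.map (λ x≉a c≈a → x≉a (K.trans (K.sym c≈x) c≈a)) x∉xs)) ⟩
        f x + 0      ≡⟨ +-identityʳ (f x) ⟩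
        f x          ≡⟨ f-resp c≈x ⟨
        f c          ∎
      found (x ∷ xs) (there c∈xs) (x∉xs ∷ u) rewrite dec-false (c ≟ x) (∉⇒≉ x∉xs c∈xs) = found xs c∈xs u

    -- φ a is only `≈` to some listed element, so the list is not permuted literally. Instead f (φ
    -- a) is expanded as an indicator sum over b, the sums are exchanged, and φ a ≈ b is read as ψ b
    -- ≈ a.
    ∑-reindex : ∀ (φ ψ : Carrier → Carrier) {f} → Respects-≈ f →
      (∀ {a b} → φ a ≈ b → ψ b ≈ a) → (∀ {a b} → ψ b ≈ a → φ a ≈ b) →
      ∑ elems (f ∘ φ) ≡ ∑ elems f
    ∑-reindex φ ψ {f} f-resp to from = begin
      ∑ elems (f ∘ φ)                                         ≡⟨ ∑-cong elems (λ a → ∑-δ (φ a) f-resp) ⟨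
      ∑ elems (λ a → ∑ elems λ b → 𝟙 (does (φ a ≟ b)) * f b)  ≡⟨ ∑-swap elems elems _ ⟩
      ∑ elems (λ b → ∑ elems λ a → 𝟙 (does (φ a ≟ b)) * f b)
        ≡⟨ ∑-cong elems (λ b → ∑-cong elems λ a → cong (_* f b) (𝟙-⇔ (φ a ≟ b) (ψ b ≟ a) to from)) ⟩
      ∑ elems (λ b → ∑ elems λ a → 𝟙 (does (ψ b ≟ a)) * f b)  ≡⟨ ∑-cong elems (λ b → ∑-δ (ψ b) {λ _ → f b} λ _ → refl) ⟩
      ∑ elems f                                               ∎

    ∑-translate : ∀ c {f} → Respects-≈ f → ∑ elems (λ a → f (a K.+ c)) ≡ ∑ elems f
    ∑-translate c f-resp = ∑-reindex (K._+ c) (K._- c) f-resp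
      (λ {a} {b} a+c≈b → K.trans (K.+-congʳ (K.sym a+c≈b)) (//-rightDividesʳ c a))
      (λ {a} {b} b-c≈a → K.trans (K.+-congʳ (K.sym b-c≈a)) (//-rightDividesˡ c b))
      where open import Algebra.Properties.Group K.+-group using (//-rightDividesˡ; //-rightDividesʳ)

    ∑-scale : ∀ {u} → ¬ u ≈ 0# → ∀ {f} → Respects-≈ f → ∑ elems (λ a → f (u K.* a)) ≡ ∑ elems f
    ∑-scale {u} u≉0 f-resp with inverse u u≉0
    ... | v , uv≈1 = ∑-reindex (u K.*_) (v K.*_) f-resp
      (λ {a} {b} ua≈b → K.trans (K.*-congˡ (K.sym ua≈b)) (cancel (K.trans (K.*-comm v u) uv≈1) a))
      (λ {a} {b} vb≈a → K.trans (K.*-congˡ (K.sym vb≈a)) (cancel uv≈1 b))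
      where
      cancel : ∀ {x y} → x K.* y ≈ 1# → ∀ z → x K.* (y K.* z) ≈ z
      cancel xy≈1 z = K.trans (K.sym (K.*-assoc _ _ z)) (K.trans (K.*-congʳ xy≈1) (K.*-identityˡ z))

    ∑-allVecs-suc : ∀ k f → ∑ (allVecs (suc k)) f ≡ ∑ elems (λ a → ∑ (allVecs k) (λ v → f (a ∷ v)))
    ∑-allVecs-suc k f = ∑-concatMap-map elems (allVecs k) _∷_ f

    ∑-allVecs-const : ∀ k n → ∑ (allVecs k) (λ _ → n) ≡ q ^ k * n
    ∑-allVecs-const zero    n = refl
    ∑-allVecs-const (suc k) n = begin
      ∑ (allVecs (suc k)) (λ _ → n)          ≡⟨ ∑-allVecs-suc k _ ⟩
      ∑ elems (λ _ → ∑ (allVecs k) λ _ → n)  ≡⟨ ∑-cong elems (λ _ → ∑-allVecs-const k n) ⟩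
      ∑ elems (λ _ → q ^ k * n)              ≡⟨ ∑-const elems _ ⟩
      q * (q ^ k * n)                        ≡⟨ *-assoc q _ n ⟨
      q * q ^ k * n                          ∎

    ∑-allVecs-++ : ∀ j k (h : Polynomial → ℕ) →
      ∑ (allVecs (j + k)) (h ∘ toList) ≡ ∑ (allVecs j) (λ u → ∑ (allVecs k) λ v → h (toList u ++ toList v))
    ∑-allVecs-++ zero    k h = sym (+-identityʳ _)
    ∑-allVecs-++ (suc j) k h = begin
      ∑ (allVecs (suc j + k)) (h ∘ toList)  ≡⟨ ∑-allVecs-suc (j + k) _ ⟩
      ∑ elems (λ a → ∑ (allVecs (j + k)) λ v → h (a ∷ toList v))
        ≡⟨ ∑-cong elems (λ a → ∑-allVecs-++ j k (h ∘ (a ∷_))) ⟩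
      ∑ elems (λ a → ∑ (allVecs j) λ u → ∑ (allVecs k) λ v → h (a ∷ toList u ++ toList v))  ≡⟨ ∑-allVecs-suc j _ ⟨
      ∑ (allVecs (suc j)) (λ u → ∑ (allVecs k) λ v → h (toList u ++ toList v))              ∎

    -- Splits off the top coefficient, whereas `allVecs` is generated from the constant term; this
    -- allows sorting polynomials by their leading coefficient.
    ∑-allVecs-∷ʳ : ∀ k (h : Polynomial → ℕ) →
      ∑ (allVecs (suc k)) (h ∘ toList) ≡ ∑ elems (λ a → ∑ (allVecs k) λ v → h (toList v ++ [ a ]))
    ∑-allVecs-∷ʳ zero    h = ∑-allVecs-suc 0 _
    ∑-allVecs-∷ʳ (suc k) h = begin
      ∑ (allVecs (suc (suc k))) (h ∘ toList)                                       ≡⟨ ∑-allVecs-suc (suc k) _ ⟩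
      ∑ elems (λ b → ∑ (allVecs (suc k)) λ v → h (b ∷ toList v))                   ≡⟨ ∑-cong elems (λ b → ∑-allVecs-∷ʳ k (h ∘ (b ∷_))) ⟩
      ∑ elems (λ b → ∑ elems λ a → ∑ (allVecs k) λ v → h (b ∷ toList v ++ [ a ]))  ≡⟨ ∑-swap elems elems _ ⟩
      ∑ elems (λ a → ∑ elems λ b → ∑ (allVecs k) λ v → h (b ∷ toList v ++ [ a ]))  ≡⟨ ∑-cong elems (λ a → ∑-allVecs-suc k _) ⟨
      ∑ elems (λ a → ∑ (allVecs (suc k)) λ v → h (toList v ++ [ a ]))              ∎

    ∷-cong : ∀ {a b f g} → a ≈ b → f ≋ g → a ∷ f ≋ b ∷ g
    ∷-cong a≈b f≋g = coefwise λ { zero → a≈b ; (suc n) → at f≋g n }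

    ∷-injective : ∀ {a b f g} → a ∷ f ≋ b ∷ g → a ≈ b × f ≋ g
    ∷-injective p = at p 0 , coefwise (at p ∘ suc)

    ∑-allVecs-translate : ∀ {k} (w : Vec Carrier k) {h} → Respects-≋ h →
      ∑ (allVecs k) (λ v → h (toList v +ₚ toList w)) ≡ ∑ (allVecs k) (h ∘ toList)
    ∑-allVecs-translate []              h-resp = refl
    ∑-allVecs-translate {suc k} (b ∷ w) {h} h-resp = begin
      ∑ (allVecs (suc k)) (λ v → h (toList v +ₚ toList (b ∷ w)))  ≡⟨ ∑-allVecs-suc k _ ⟩
      ∑ elems (λ a → ∑ (allVecs k) λ v → h (a K.+ b ∷ toList v +ₚ toList w))
        ≡⟨ ∑-cong elems (λ a → ∑-allVecs-translate w (h-resp ∘ ∷-cong K.refl)) ⟩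
      ∑ elems (λ a → ∑ (allVecs k) λ v → h (a K.+ b ∷ toList v))
        ≡⟨ ∑-translate b (λ a≈a′ → ∑-cong (allVecs k) λ v → h-resp (∷-cong a≈a′ P.refl)) ⟩
      ∑ elems (λ a → ∑ (allVecs k) λ v → h (a ∷ toList v))  ≡⟨ ∑-allVecs-suc k _ ⟨
      ∑ (allVecs (suc k)) (h ∘ toList)                      ∎

    ∑-allVecs-scale : ∀ k {u} → ¬ u ≈ 0# → ∀ {h} → Respects-≋ h →
      ∑ (allVecs k) (λ v → h (map (u K.*_) (toList v))) ≡ ∑ (allVecs k) (h ∘ toList)
    ∑-allVecs-scale zero    u≉0 h-resp = refl
    ∑-allVecs-scale (suc k) {u} u≉0 {h} h-resp = begin
      ∑ (allVecs (suc k)) (λ v → h (map (u K.*_) (toList v)))  ≡⟨ ∑-allVecs-suc k _ ⟩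
      ∑ elems (λ a → ∑ (allVecs k) λ v → h (u K.* a ∷ map (u K.*_) (toList v)))
        ≡⟨ ∑-cong elems (λ a → ∑-allVecs-scale k u≉0 (h-resp ∘ ∷-cong K.refl)) ⟩
      ∑ elems (λ a → ∑ (allVecs k) λ v → h (u K.* a ∷ toList v))
        ≡⟨ ∑-scale u≉0 (λ a≈a′ → ∑-cong (allVecs k) λ v → h-resp (∷-cong a≈a′ P.refl)) ⟩
      ∑ elems (λ a → ∑ (allVecs k) λ v → h (a ∷ toList v))  ≡⟨ ∑-allVecs-suc k _ ⟨
      ∑ (allVecs (suc k)) (h ∘ toList)                      ∎

    -- Multiplication by x^k.
    shift : ℕ → Polynomial → Polynomial
    shift k f = replicate k 0# ++ f

    toList-++≋ : ∀ {k} (v : Vec Carrier k) f → toList v ++ f ≋ toList v +ₚ shift k f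
    toList-++≋ []      f = P.refl
    toList-++≋ (a ∷ v) f = ∷-cong (K.sym (K.+-identityʳ a)) (toList-++≋ v f)

    scale-shift : ∀ k u f → map (u K.*_) (shift k f) ≋ shift k (map (u K.*_) f)
    scale-shift zero    u f = P.refl
    scale-shift (suc k) u f = ∷-cong (K.zeroʳ u) (scale-shift k u f)

    scale-+ : ∀ u f g → map (u K.*_) (f +ₚ g) ≋ map (u K.*_) f +ₚ map (u K.*_) g
    scale-+ u []      g       = P.refl
    scale-+ u (a ∷ f) []      = P.refl
    scale-+ u (a ∷ f) (b ∷ g) = ∷-cong (K.distribˡ u a b) (scale-+ u f g)

    ∑-allVecs-δ : ∀ {k} (c : Vec Carrier k) {h} → Respects-≋ h →
      ∑ (allVecs k) (λ v → 𝟙 (does (toList c ≋? toList v)) * h (toList v)) ≡ h (toList c)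
    ∑-allVecs-δ []              {h} h-resp = trans (+-identityʳ _) (+-identityʳ _)
    ∑-allVecs-δ {suc k} (a ∷ c) {h} h-resp = begin
      ∑ (allVecs (suc k)) (λ v → 𝟙 (does (a ∷ toList c ≋? toList v)) * h (toList v))
        ≡⟨ ∑-allVecs-suc k _ ⟩
      ∑ elems (λ b → ∑ (allVecs k) λ v → 𝟙 (does (a ∷ toList c ≋? b ∷ toList v)) * h (b ∷ toList v))
        ≡⟨ ∑-cong elems (λ b → trans (∑-cong (allVecs k) (separate b)) (∑-distribˡ-* (allVecs k) (𝟙 (does (a ≟ b))) _)) ⟩
      ∑ elems (λ b → 𝟙 (does (a ≟ b)) * ∑ (allVecs k) λ v → 𝟙 (does (toList c ≋? toList v)) * h (b ∷ toList v))
        ≡⟨ ∑-cong elems (λ b → cong (𝟙 (does (a ≟ b)) *_) (∑-allVecs-δ c (h-resp ∘ ∷-cong K.refl))) ⟩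
      ∑ elems (λ b → 𝟙 (does (a ≟ b)) * h (b ∷ toList c))
        ≡⟨ ∑-δ a (λ b≈b′ → h-resp (∷-cong b≈b′ P.refl)) ⟩
      h (a ∷ toList c) ∎
      where
      separate : ∀ b v → 𝟙 (does (a ∷ toList c ≋? b ∷ toList v)) * h (b ∷ toList v) ≡
                         𝟙 (does (a ≟ b)) * (𝟙 (does (toList c ≋? toList v)) * h (b ∷ toList v))
      separate b v = trans (cong (_* h (b ∷ toList v)) (trans
        (𝟙-⇔ (a ∷ toList c ≋? b ∷ toList v) (a ≟ b ×-dec toList c ≋? toList v) ∷-injective λ (p , r) → ∷-cong p r)
        (𝟙-∧ (does (a ≟ b)) _))) (*-assoc (𝟙 (does (a ≟ b))) _ _)

    -- Adding the fixed term x^m is injective, so equality of monic polynomials of degree m reduces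
    -- to equality of their m lower coefficients.
    ∑-𝓜-δ : ∀ m {f} → IsMonic m f → ∀ {h} → Respects-≋ h →
      ∑ (𝓜 m) (λ s → 𝟙 (does (f ≋? poly s)) * h (poly s)) ≡ h f
    ∑-𝓜-δ m {f} f-monic {h} h-resp = begin
      ∑ (𝓜 m) (λ s → 𝟙 (does (f ≋? poly s)) * h (poly s))
        ≡⟨ ∑-cong (𝓜 m) (λ s → cong₂ _*_ (𝟙-⇔ (f ≋? poly s) (toList c ≋? toList s) (to s) (from s)) (h-resp (toList-++≋ s _))) ⟩
      ∑ (𝓜 m) (λ s → 𝟙 (does (toList c ≋? toList s)) * h (toList s +ₚ x^m))
        ≡⟨ ∑-allVecs-δ c (λ p → h-resp (P.+-congʳ p)) ⟩
      h (toList c +ₚ x^m)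
        ≡⟨ h-resp f≋ ⟨
      h f ∎
      where
      c = lower m f
      x^m = shift m [ 1# ]
      f≋ : f ≋ toList c +ₚ x^m
      f≋ = P.trans (P.sym (poly-lower f-monic)) (toList-++≋ c _)
      to : ∀ s → f ≋ poly s → toList c ≋ toList s
      to s p = ∙-cancelʳ x^m _ _ (P.trans (P.sym f≋) (P.trans p (toList-++≋ s _)))
      from : ∀ s → toList c ≋ toList s → f ≋ poly s
      from s p = P.trans f≋ (P.trans (P.+-congʳ p) (P.sym (toList-++≋ s _)))

    -- A cofactor is unique because the monic d cancels, and it is monic of degree n because f and d
    -- are monic. The number of cofactors is therefore the indicator of divisibility.
    ∑-cofactors : ∀ {c} (d : Monic c) n {f} → IsMonic (n + c) f →
      ∑ (𝓜 n) (λ e → 𝟙 (does (f ≋? poly e *ₚ poly d))) ≡ 𝟙 (does (d ∣? f))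
    ∑-cofactors d n {f} f-monic with d ∣? f
    ... | yes (h , hd≋f) = begin
      ∑ (𝓜 n) (λ e → 𝟙 (does (f ≋? poly e *ₚ poly d)))
        ≡⟨ ∑-cong (𝓜 n) (λ e → trans (𝟙-⇔ (f ≋? poly e *ₚ poly d) (h ≋? poly e) (to e) (from e)) (sym (*-identityʳ _))) ⟩
      ∑ (𝓜 n) (λ e → 𝟙 (does (h ≋? poly e)) * 1)
        ≡⟨ ∑-𝓜-δ n {h} (IsMonic-cofactor d-monic n {h} (IsMonic-resp-≋ (P.sym hd≋f) f-monic)) (λ _ → refl) ⟩
      1                                                   ∎
      where
      d-monic = poly-IsMonic d
      to : ∀ e → f ≋ poly e *ₚ poly d → h ≋ poly e
      to e p = *ₚ-cancelʳ d-monic h (poly e) (P.trans hd≋f p)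
      from : ∀ e → h ≋ poly e → f ≋ poly e *ₚ poly d
      from e p = P.trans (P.sym hd≋f) (P.*-congʳ p)
    ... | no d∤f = trans (∑-cong (𝓜 n) λ e → cong 𝟙 (dec-false (f ≋? poly e *ₚ poly d) λ p → d∤f (poly e , P.sym p))) (∑-zero (𝓜 n))

    Periodic : Polynomial → (Polynomial → ℕ) → Set
    Periodic d h = ∀ f g → h (f +ₚ g *ₚ d) ≡ h f

    module _ {c} (d : Monic c) {h} (h-resp : Respects-≋ h) (h-periodic : Periodic (poly d) h) where

      -- Vectors of length c form a complete residue system modulo d, which translation by f
      -- permutes: periodicity discards the multiple of d in f, and the remainder acts as a
      -- translation of vectors.
      ∑-residues-translate : ∀ f → ∑ (allVecs c) (λ v → h (toList v +ₚ f)) ≡ ∑ (allVecs c) (h ∘ toList)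
      ∑-residues-translate f with divide (poly-IsMonic d) f
      ... | (g , w) , f≋ = begin
        ∑ (allVecs c) (λ v → h (toList v +ₚ f))
          ≡⟨ ∑-cong (allVecs c) (λ v → h-resp (P.trans (P.+-congˡ {toList v} f≋) (x∙yz≈xz∙y (toList v) (g *ₚ poly d) (toList w)))) ⟩
        ∑ (allVecs c) (λ v → h (toList v +ₚ toList w +ₚ g *ₚ poly d))
          ≡⟨ ∑-cong (allVecs c) (λ v → h-periodic (toList v +ₚ toList w) g) ⟩
        ∑ (allVecs c) (λ v → h (toList v +ₚ toList w))
          ≡⟨ ∑-allVecs-translate w h-resp ⟩
        ∑ (allVecs c) (h ∘ toList) ∎
        where open import Algebra.Properties.CommutativeSemigroup P.+-commutativeSemigroup using (x∙yz≈xz∙y)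

      -- For each of the q^i choices of the coefficients from degree c to c + i - 1, the c lower
      -- ones run through a translated complete residue system.
      ∑-𝓜-periodic : ∀ i → ∑ (𝓜 (c + i)) (h ∘ poly) ≡ q ^ i * ∑ (allVecs c) (h ∘ toList)
      ∑-𝓜-periodic i = begin
        ∑ (𝓜 (c + i)) (h ∘ poly)
          ≡⟨ ∑-allVecs-++ c i (λ f → h (f ++ [ 1# ])) ⟩
        ∑ (allVecs c) (λ v → ∑ (allVecs i) λ w → h ((toList v ++ toList w) ++ [ 1# ]))
          ≡⟨ ∑-swap (allVecs c) (allVecs i) _ ⟩
        ∑ (allVecs i) (λ w → ∑ (allVecs c) λ v → h ((toList v ++ toList w) ++ [ 1# ]))
          ≡⟨ ∑-cong (allVecs i) (λ w → trans
               (∑-cong (allVecs c) λ v → trans (cong h (++-assoc (toList v) (toList w) [ 1# ])) (h-resp (toList-++≋ v (poly w))))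
               (∑-residues-translate (shift c (poly w)))) ⟩
        ∑ (allVecs i) (λ w → ∑ (allVecs c) (h ∘ toList))
          ≡⟨ ∑-allVecs-const i _ ⟩
        q ^ i * ∑ (allVecs c) (h ∘ toList) ∎

    q≡1+[q∸1] : q ≡ suc (q ∸ 1)
    q≡1+[q∸1] = sym (ℕ.suc-pred q {{card-nonZero F}})

    -- Sorted by the coefficient a at x^k: a = 0 leaves the polynomials of degree below k, and each
    -- of the q - 1 nonzero values gives a times the monic polynomials of degree k, on which h does
    -- not see a.
    ∑-allVecs-homogeneous : ∀ k {h} → Respects-≋ h → (∀ {u} → ¬ u ≈ 0# → ∀ f → h (map (u K.*_) f) ≡ h f) →
      ∑ (allVecs (suc k)) (h ∘ toList) ≡ ∑ (allVecs k) (h ∘ toList) + (q ∸ 1) * ∑ (𝓜 k) (h ∘ poly)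
    -- Adding M to both sides lets a = 0 contribute an M like every other a, so M is summed over all
    -- of `elems` and the nonzero elements need not be listed.
    ∑-allVecs-homogeneous k {h} h-resp h-scale = +-cancelʳ-≡ M _ _ (begin
      ∑ (allVecs (suc k)) (h ∘ toList) + M                       ≡⟨ cong₂ _+_ (∑-allVecs-∷ʳ k h) (sym (∑-δ 0# {λ _ → M} λ _ → refl)) ⟩
      ∑ elems t + ∑ elems (λ a → 𝟙 (does (0# ≟ a)) * M)          ≡⟨ ∑-distrib-+ elems t _ ⟨
      ∑ elems (λ a → t a + 𝟙 (does (0# ≟ a)) * M)                ≡⟨ ∑-cong elems top ⟩
      ∑ elems (λ a → 𝟙 (does (0# ≟ a)) * L + M)                  ≡⟨ ∑-distrib-+ elems _ _ ⟩
      ∑ elems (λ a → 𝟙 (does (0# ≟ a)) * L) + ∑ elems (λ _ → M)  ≡⟨ cong₂ _+_ (∑-δ 0# {λ _ → L} λ _ → refl) (∑-const elems M) ⟩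
      L + q * M                                                  ≡⟨ cong (λ n → L + n * M) q≡1+[q∸1] ⟩
      L + (M + (q ∸ 1) * M)                                      ≡⟨ cong (L +_) (+-comm M _) ⟩
      L + ((q ∸ 1) * M + M)                                      ≡⟨ +-assoc L _ M ⟨
      L + (q ∸ 1) * M + M                                        ∎)
      where
      L = ∑ (allVecs k) (h ∘ toList)
      M = ∑ (𝓜 k) (h ∘ poly)
      t : Carrier → ℕ
      t a = ∑ (allVecs k) λ v → h (toList v ++ [ a ])
      top : ∀ a → t a + 𝟙 (does (0# ≟ a)) * M ≡ 𝟙 (does (0# ≟ a)) * L + M
      top a with 0# ≟ a
      ... | yes 0≈a = cong₂ _+_ (trans (∑-cong (allVecs k) λ v → h-resp (append-zero v)) (sym (+-identityʳ L))) (+-identityʳ M)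
        where
        shift-zero : ∀ k → shift k [ a ] ≋ []
        shift-zero zero    = ∷≋[] (K.sym 0≈a) P.refl
        shift-zero (suc k) = ∷≋[] K.refl (shift-zero k)
        append-zero : ∀ v → toList v ++ [ a ] ≋ toList v
        append-zero v = P.trans (toList-++≋ v _) (P.trans (P.+-congˡ {toList v} (shift-zero k)) (P.+-identityʳ _))
      ... | no  0≉a = trans (+-identityʳ _) (begin
        t a
          ≡⟨ ∑-cong (allVecs k) (λ v → h-resp (toList-++≋ v _)) ⟩
        -- Replacing v by a v permutes the lower coefficients, after which a factors out of the
        -- whole polynomial.
        ∑ (allVecs k) (λ v → h (toList v +ₚ shift k [ a ]))
          ≡⟨ ∑-allVecs-scale k a≉0 {λ f → h (f +ₚ shift k [ a ])} (λ p → h-resp (P.+-congʳ p)) ⟨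
        ∑ (allVecs k) (λ v → h (map (a K.*_) (toList v) +ₚ shift k [ a ]))
          ≡⟨ ∑-cong (allVecs k) (λ v → h-resp (factor v)) ⟩
        ∑ (allVecs k) (λ v → h (map (a K.*_) (toList v +ₚ shift k [ 1# ])))
          ≡⟨ ∑-cong (allVecs k) (λ v → trans (h-scale a≉0 _) (sym (h-resp (toList-++≋ v _)))) ⟩
        M ∎)
        where
        a≉0 : ¬ a ≈ 0#
        a≉0 a≈0 = 0≉a (K.sym a≈0)
        shift-cong : ∀ k {f g} → f ≋ g → shift k f ≋ shift k g
        shift-cong zero    p = p
        shift-cong (suc k) p = ∷-cong K.refl (shift-cong k p)
        factor : ∀ v → map (a K.*_) (toList v) +ₚ shift k [ a ] ≋ map (a K.*_) (toList v +ₚ shift k [ 1# ])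
        factor v = P.trans (P.+-congˡ {map (a K.*_) (toList v)}
            (P.trans (shift-cong k (∷-cong (K.sym (K.*-identityʳ a)) P.refl)) (P.sym (scale-shift k a [ 1# ]))))
          (P.sym (scale-+ a (toList v) _))

  -- Counting the solutions of f e = d g by descent

  module Counting (F : FiniteField) where
    open FiniteField F using (0#; _≈_) renaming (card to q)
    open Poly F using (Polynomial; _+ₚ_; _*ₚ_; Monic; poly; allVecs; 𝓜)
    open PolynomialRing F
    open Divisibility F
    open Sums F
    open import Algebra.Properties.CommutativeSemigroup P.*-commutativeSemigroup using (xy∙z≈xz∙y)
    open import Algebra.Properties.Group P.+-group using (//-rightDividesʳ)

    p : ℕ
    p = q ∸ 1

    divides : ∀ {c} → Monic c → Polynomial → ℕ
    divides d f = 𝟙 (does (d ∣? f))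

    divides-cong : ∀ {c} (d : Monic c) {f g} → (∀ h → h *ₚ poly d ≋ f → poly d ∣ g) → (∀ h → h *ₚ poly d ≋ g → poly d ∣ f) →
      divides d f ≡ divides d g
    divides-cong d {f} {g} to from = 𝟙-⇔ (d ∣? f) (d ∣? g) (λ (h , e) → to h e) (λ (h , e) → from h e)

    divides-resp : ∀ {c} (d : Monic c) → Respects-≋ (divides d)
    divides-resp d f≋g = divides-cong d (λ h e → h , P.trans e f≋g) (λ h e → h , P.trans e (P.sym f≋g))

    -- (f + g d) e and f e differ by the multiple g e d of d, so their quotients by d differ by g e.
    divides-periodic : ∀ {c} (d : Monic c) e → Periodic (poly d) (λ f → divides d (f *ₚ e))
    divides-periodic d e f g = divides-cong d
      (λ h hd≋ → h P.- g *ₚ e , (begin≋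
        (h P.- g *ₚ e) *ₚ poly d                             ≈⟨ [y-z]x≈yx-zx (poly d) h (g *ₚ e) ⟩
        (h *ₚ poly d) P.- (g *ₚ e *ₚ poly d)                 ≈⟨ P.+-cong (P.trans hd≋ (expand f g)) (P.-‿cong P.refl) ⟩
        (f *ₚ e +ₚ g *ₚ e *ₚ poly d) P.- (g *ₚ e *ₚ poly d)  ≈⟨ //-rightDividesʳ (g *ₚ e *ₚ poly d) (f *ₚ e) ⟩
        f *ₚ e                                               ∎≋))
      (λ h hd≋ → h +ₚ g *ₚ e , P.trans (P.distribʳ (poly d) h (g *ₚ e)) (P.trans (P.+-congʳ hd≋) (P.sym (expand f g))))
      where
      open import Relation.Binary.Reasoning.Setoid P.setoid using (step-≈-⟩; step-≈-⟨) renaming (begin_ to begin≋_; _∎ to _∎≋)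
      open import Algebra.Properties.Ring P.ring using ([y-z]x≈yx-zx)
      expand : ∀ f g → (f +ₚ g *ₚ poly d) *ₚ e ≋ f *ₚ e +ₚ g *ₚ e *ₚ poly d
      expand f g = P.trans (P.distribʳ e f (g *ₚ poly d)) (P.+-congˡ {f *ₚ e} (xy∙z≈xz∙y g (poly d) e))

    scale≋* : ∀ u f → map (u K.*_) f ≋ (u ∷ []) *ₚ f
    scale≋* u f = P.trans (P.sym (P.+-identityʳ _)) (P.+-congˡ {map (u K.*_) f} (P.sym (∷≋[] K.refl P.refl)))

    divides-scale : ∀ {c} (d : Monic c) e {u} → ¬ u ≈ 0# → ∀ f → divides d (map (u K.*_) f *ₚ e) ≡ divides d (f *ₚ e)
    divides-scale d e {u} u≉0 f with K.inverse u u≉0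
    ... | v , uv≈1 = divides-cong d
      (λ h hd≋ → (v ∷ []) *ₚ h , P.trans (P.*-assoc (v ∷ []) h (poly d)) (P.trans (P.*-congˡ {v ∷ []} (P.trans hd≋ scaled)) cancel))
      (λ h hd≋ → (u ∷ []) *ₚ h , P.trans (P.*-assoc (u ∷ []) h (poly d)) (P.trans (P.*-congˡ {u ∷ []} hd≋) (P.sym scaled)))
      where
      scaled : map (u K.*_) f *ₚ e ≋ (u ∷ []) *ₚ (f *ₚ e)
      scaled = P.trans (P.*-congʳ {e} (scale≋* u f)) (P.*-assoc (u ∷ []) f e)
      vu≋1 : (v ∷ []) *ₚ (u ∷ []) ≋ 1ₚ
      vu≋1 = ∷-cong (K.trans (K.+-identityʳ _) (K.trans (K.*-comm v u) uv≈1)) P.refl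
      cancel : (v ∷ []) *ₚ ((u ∷ []) *ₚ (f *ₚ e)) ≋ f *ₚ e
      cancel = P.trans (P.sym (P.*-assoc (v ∷ []) (u ∷ []) (f *ₚ e))) (P.trans (P.*-congʳ {f *ₚ e} vu≋1) (P.*-identityˡ (f *ₚ e)))

    -- Since d ∣ f e says d g = f e for a unique monic g, this counts monic (f, e, d, g) with f e = d g.
    #monic : ℕ → ℕ → ℕ → ℕ
    #monic a b c = ∑ (𝓜 b) λ e → ∑ (𝓜 c) λ d → ∑ (𝓜 a) λ f → divides d (poly f *ₚ poly e)

    -- Here f is any polynomial of degree below k, zero included. For k = c it runs through the
    -- residues modulo d; smaller k are the intermediate stages when residues are sorted by degree.
    #below : ℕ → ℕ → ℕ → ℕ
    #below k b c = ∑ (𝓜 b) λ e → ∑ (𝓜 c) λ d → ∑ (allVecs k) λ f → divides d (toList f *ₚ poly e)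

    #monic-comm : ∀ a b c → #monic a b c ≡ #monic b a c
    #monic-comm a b c = begin
      (∑ (𝓜 b) λ e → ∑ (𝓜 c) λ d → ∑ (𝓜 a) λ f → divides d (poly f *ₚ poly e))
        ≡⟨ ∑-reverse₃ (𝓜 b) (𝓜 c) (𝓜 a) _ ⟩
      (∑ (𝓜 a) λ f → ∑ (𝓜 c) λ d → ∑ (𝓜 b) λ e → divides d (poly f *ₚ poly e))
        ≡⟨ ∑-cong (𝓜 a) (λ f → ∑-cong (𝓜 c) λ d → ∑-cong (𝓜 b) λ e → divides-resp d (P.*-comm (poly f) (poly e))) ⟩
      #monic b a c ∎

    -- Counts the cofactors g in place of the indicator of divisibility, so that all four
    -- polynomials appear as summation variables and the symmetry of the equation becomes usable.
    #monic-expand : ∀ a b c d → a + b ≡ c + d →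
      #monic a b c ≡ (∑ (𝓜 b) λ e → ∑ (𝓜 c) λ x → ∑ (𝓜 a) λ f → ∑ (𝓜 d) λ g → 𝟙 (does (poly f *ₚ poly e ≋? poly g *ₚ poly x)))
    #monic-expand a b c d a+b≡c+d = ∑-cong (𝓜 b) λ e → ∑-cong (𝓜 c) λ x → ∑-cong (𝓜 a) λ f →
      sym (∑-cofactors x d (subst (λ n → IsMonic n (poly f *ₚ poly e)) (trans a+b≡c+d (+-comm c d)) (IsMonic-* (poly-IsMonic e) a (poly-IsMonic f))))

    -- The equation f e = g x is read from its other side: the condition that x divides f e becomes
    -- the condition that f divides x g.
    #monic-exchange : ∀ a b c d → a + b ≡ c + d → #monic a b c ≡ #monic c d a
    #monic-exchange a b c d a+b≡c+d = begin
      #monic a b c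
        ≡⟨ #monic-expand a b c d a+b≡c+d ⟩
      (∑ (𝓜 b) λ e → ∑ (𝓜 c) λ x → ∑ (𝓜 a) λ f → ∑ (𝓜 d) λ g → 𝟙 (does (poly f *ₚ poly e ≋? poly g *ₚ poly x)))
        ≡⟨ ∑-reverse₄ (𝓜 b) (𝓜 c) (𝓜 a) (𝓜 d) _ ⟩
      (∑ (𝓜 d) λ g → ∑ (𝓜 a) λ f → ∑ (𝓜 c) λ x → ∑ (𝓜 b) λ e → 𝟙 (does (poly f *ₚ poly e ≋? poly g *ₚ poly x)))
        ≡⟨ ∑-cong (𝓜 d) (λ g → ∑-cong (𝓜 a) λ f → ∑-cong (𝓜 c) λ x → ∑-cong (𝓜 b) λ e →
             𝟙-⇔ (poly f *ₚ poly e ≋? poly g *ₚ poly x) (poly x *ₚ poly g ≋? poly e *ₚ poly f)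
               (commuted {poly f} {poly e} {poly g} {poly x}) (commuted {poly x} {poly g} {poly e} {poly f})) ⟩
      (∑ (𝓜 d) λ g → ∑ (𝓜 a) λ f → ∑ (𝓜 c) λ x → ∑ (𝓜 b) λ e → 𝟙 (does (poly x *ₚ poly g ≋? poly e *ₚ poly f)))
        ≡⟨ #monic-expand c d a b (sym a+b≡c+d) ⟨
      #monic c d a ∎
      where
      commuted : ∀ {f e g x} → f *ₚ e ≋ g *ₚ x → x *ₚ g ≋ e *ₚ f
      commuted {f} {e} {g} {x} eq = P.trans (P.*-comm x g) (P.trans (P.sym eq) (P.*-comm f e))

    -- Divisibility of f e by d depends on f modulo d, and each residue is attained by q^(a-c) monic
    -- f of degree a.
    #monic-periodic : ∀ {a c} b → c ≤ a → #monic a b c ≡ q ^ (a ∸ c) * #below c b c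
    #monic-periodic {a} {c} b c≤a = begin
      #monic a b c
        ≡⟨ cong (λ n → #monic n b c) (ℕ.m+[n∸m]≡n c≤a) ⟨
      #monic (c + (a ∸ c)) b c
        ≡⟨ ∑-cong (𝓜 b) (λ e → trans
             (∑-cong (𝓜 c) λ d → ∑-𝓜-periodic d (λ f≋g → divides-resp d (P.*-congʳ f≋g)) (divides-periodic d (poly e)) (a ∸ c))
             (∑-distribˡ-* (𝓜 c) (q ^ (a ∸ c)) _)) ⟩
      ∑ (𝓜 b) (λ e → q ^ (a ∸ c) * ∑ (𝓜 c) λ d → ∑ (allVecs c) λ f → divides d (toList f *ₚ poly e))
        ≡⟨ ∑-distribˡ-* (𝓜 b) (q ^ (a ∸ c)) _ ⟩
      q ^ (a ∸ c) * #below c b c ∎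

    #below-suc : ∀ k b c → #below (suc k) b c ≡ #below k b c + p * #monic k b c
    #below-suc k b c = begin
      #below (suc k) b c
        ≡⟨ ∑-cong (𝓜 b) (λ e → ∑-cong (𝓜 c) λ d →
             ∑-allVecs-homogeneous k (λ f≋g → divides-resp d (P.*-congʳ f≋g)) (divides-scale d (poly e))) ⟩
      ∑ (𝓜 b) (λ e → ∑ (𝓜 c) λ d → s e d + p * t e d)
        ≡⟨ ∑-cong (𝓜 b) (λ e → trans (∑-distrib-+ (𝓜 c) (s e) _) (cong (∑ (𝓜 c) (s e) +_) (∑-distribˡ-* (𝓜 c) p (t e)))) ⟩
      ∑ (𝓜 b) (λ e → ∑ (𝓜 c) (s e) + p * ∑ (𝓜 c) (t e))
        ≡⟨ trans (∑-distrib-+ (𝓜 b) _ _) (cong (#below k b c +_) (∑-distribˡ-* (𝓜 b) p _)) ⟩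
      #below k b c + p * #monic k b c ∎
      where
      s t : Monic b → Monic c → ℕ
      s e d = ∑ (allVecs k) λ f → divides d (toList f *ₚ poly e)
      t e d = ∑ (𝓜 k) λ f → divides d (poly f *ₚ poly e)

    #below-zero : ∀ b c → #below 0 b c ≡ q ^ b * q ^ c
    #below-zero b c = begin
      #below 0 b c
        ≡⟨ ∑-cong (𝓜 b) (λ e → ∑-cong (𝓜 c) λ d → trans (+-identityʳ _) (cong 𝟙 (dec-true (d ∣? []) ([] , P.refl)))) ⟩
      ∑ (𝓜 b) (λ _ → ∑ (𝓜 c) λ _ → 1)
        ≡⟨ ∑-allVecs-const b _ ⟩
      q ^ b * ∑ (𝓜 c) (λ _ → 1)
        ≡⟨ cong (q ^ b *_) (trans (∑-allVecs-const c 1) (*-identityʳ _)) ⟩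
      q ^ b * q ^ c ∎

    -- Both identities are multiplied by q, since the closed forms of the counts contain q^(k−1).
    mutual
      #below-closed : ∀ k {b c} → k ≤ c → c ≤ b → q * #below k b c ≡ q ^ b * (q * q ^ c + k * p * q ^ k)
      #below-closed zero    {b} {c} _   _   = trans (cong (q *_) (#below-zero b c)) (rearrange q (q ^ b) (q ^ c))
        where
        rearrange : ∀ q y z → q * (y * z) ≡ y * (q * z + 0)
        rearrange = solve-∀
      #below-closed (suc k) {b} {c} k<c c≤b = begin
        q * #below (suc k) b c                  ≡⟨ cong (q *_) (#below-suc k b c) ⟩
        -- The descent: f of degree k becomes the divisor. Since c ≤ b, the new cofactor degree b′ =
        -- k + (b - c) is at least k, so k is the least of the four degrees and `#monic-least`
        -- applies to it.
        q * (#below k b c + p * #monic k b c)   ≡⟨ cong (λ n → q * (#below k b c + p * n)) (#monic-exchange k b c b′ k+b≡c+b′) ⟩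
        q * (#below k b c + p * #monic c b′ k)  ≡⟨ distribute q p _ _ ⟩
        q * #below k b c + p * (q * #monic c b′ k)
          ≡⟨ cong₂ (λ m n → m + p * n) (#below-closed k k≤c c≤b) (#monic-least k k≤c (ℕ.m≤m+n k (b ∸ c))) ⟩
        q ^ b * (q * q ^ c + k * p * q ^ k) + p * (q ^ (c + b′) * (q + k * p))
          ≡⟨ cong (λ n → q ^ b * (q * q ^ c + k * p * q ^ k) + p * (n * (q + k * p)))
               (trans (cong (q ^_) (sym k+b≡c+b′)) (ℕ.^-distribˡ-+-* q k b)) ⟩
        q ^ b * (q * q ^ c + k * p * q ^ k) + p * (q ^ k * q ^ b * (q + k * p))
          ≡⟨ collect (q ^ k) (q ^ b) (q ^ c) ⟩
        q ^ b * (q * q ^ c + suc k * p * q ^ suc k) ∎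
        where
        k≤c : k ≤ c
        k≤c = ℕ.<⇒≤ k<c
        b′ : ℕ
        b′ = k + (b ∸ c)
        k+b≡c+b′ : k + b ≡ c + b′
        k+b≡c+b′ = begin
          k + b              ≡⟨ cong (k +_) (ℕ.m+[n∸m]≡n c≤b) ⟨
          k + (c + (b ∸ c))  ≡⟨ x∙yz≈y∙xz k c (b ∸ c) ⟩
          c + b′             ∎
          where open import Algebra.Properties.CommutativeSemigroup ℕ.+-commutativeSemigroup using (x∙yz≈y∙xz)
        distribute : ∀ q p s t → q * (s + p * t) ≡ q * s + p * (q * t)
        distribute = solve-∀
        -- With q = 1 + p, k + q + k p equals (k + 1) q. This is the telescoping that carries k p
        -- q^k to (k + 1) p q^(k+1).
        collect′ : ∀ p k x y z → y * ((1 + p) * z + k * p * x) + p * (x * y * ((1 + p) + k * p)) ≡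
                                 y * ((1 + p) * z + (1 + k) * p * ((1 + p) * x))
        collect′ = solve-∀
        collect : ∀ x y z → y * (q * z + k * p * x) + p * (x * y * (q + k * p)) ≡ y * (q * z + suc k * p * (q * x))
        collect x y z = subst (λ r → y * (r * z + k * p * x) + p * (x * y * (r + k * p)) ≡ y * (r * z + suc k * p * (r * x)))
          (sym q≡1+[q∸1]) (collect′ p k x y z)

      #monic-least : ∀ k {a b} → k ≤ a → k ≤ b → q * #monic a b k ≡ q ^ (a + b) * (q + k * p)
      #monic-least k {a} {b} k≤a k≤b = begin
        q * #monic a b k                                     ≡⟨ cong (q *_) (#monic-periodic b k≤a) ⟩
        q * (q ^ (a ∸ k) * #below k b k)                     ≡⟨ x∙yz≈y∙xz q (q ^ (a ∸ k)) _ ⟩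
        q ^ (a ∸ k) * (q * #below k b k)                     ≡⟨ cong (q ^ (a ∸ k) *_) (#below-closed k ℕ.≤-refl k≤b) ⟩
        q ^ (a ∸ k) * (q ^ b * (q * q ^ k + k * p * q ^ k))  ≡⟨ collect (q ^ (a ∸ k)) (q ^ b) q (q ^ k) k p ⟩
        q ^ k * q ^ (a ∸ k) * q ^ b * (q + k * p)
          ≡⟨ cong (λ n → n * q ^ b * (q + k * p)) (trans (sym (ℕ.^-distribˡ-+-* q k (a ∸ k))) (cong (q ^_) (ℕ.m+[n∸m]≡n k≤a))) ⟩
        q ^ a * q ^ b * (q + k * p)  ≡⟨ cong (_* (q + k * p)) (ℕ.^-distribˡ-+-* q a b) ⟨
        q ^ (a + b) * (q + k * p)    ∎
        where
        open import Algebra.Properties.CommutativeSemigroup ℕ.*-commutativeSemigroup using (x∙yz≈y∙xz)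
        collect : ∀ w y q x k p → w * (y * (q * x + k * p * x)) ≡ x * w * y * (q + k * p)
        collect = solve-∀

    -- The closed form for degrees in any order

    -- The count itself mentions only a, b and c; d stands for the cofactor degree a + b - c and is
    -- kept so that the minimum is visibly symmetric.
    Closed : ℕ → ℕ → ℕ → ℕ → Set
    Closed a b c d = q * #monic a b c ≡ q ^ (a + b) * (q + ((a ⊓ b) ⊓ (c ⊓ d)) * p)

    -- Once each side is sorted, the least degree is a or c. If it is a, exchanging the sides makes
    -- it the degree of the divisor.
    Closed-sorted : ∀ a b c d → a + b ≡ c + d → a ≤ b → c ≤ d → Closed a b c d
    Closed-sorted a b c d a+b≡c+d a≤b c≤d rewrite ℕ.m≤n⇒m⊓n≡m a≤b | ℕ.m≤n⇒m⊓n≡m c≤d with ℕ.≤-total a c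
    ... | inj₁ a≤c rewrite ℕ.m≤n⇒m⊓n≡m a≤c | #monic-exchange a b c d a+b≡c+d | a+b≡c+d = #monic-least a a≤c (ℕ.≤-trans a≤c c≤d)
    ... | inj₂ c≤a rewrite ℕ.m≥n⇒m⊓n≡n c≤a = #monic-least c c≤a (ℕ.≤-trans c≤a a≤b)

    Closed-swapˡ : ∀ a b c d → Closed b a c d → Closed a b c d
    Closed-swapˡ a b c d closed = begin
      q * #monic a b c                             ≡⟨ cong (q *_) (#monic-comm a b c) ⟩
      q * #monic b a c                             ≡⟨ closed ⟩
      q ^ (b + a) * (q + ((b ⊓ a) ⊓ (c ⊓ d)) * p)  ≡⟨ cong₂ (λ m n → q ^ m * (q + (n ⊓ (c ⊓ d)) * p)) (+-comm b a) (ℕ.⊓-comm b a) ⟩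
      q ^ (a + b) * (q + ((a ⊓ b) ⊓ (c ⊓ d)) * p)  ∎

    -- Divisor and cofactor trade places by turning the equation around, commuting the product, and
    -- turning it back.
    Closed-swapʳ : ∀ a b c d → a + b ≡ c + d → Closed a b d c → Closed a b c d
    Closed-swapʳ a b c d a+b≡c+d closed = begin
      q * #monic a b c                             ≡⟨ cong (q *_) (#monic-exchange a b c d a+b≡c+d) ⟩
      q * #monic c d a                             ≡⟨ cong (q *_) (#monic-comm c d a) ⟩
      q * #monic d c a                             ≡⟨ cong (q *_) (#monic-exchange a b d c (trans a+b≡c+d (+-comm c d))) ⟨
      q * #monic a b d                             ≡⟨ closed ⟩
      q ^ (a + b) * (q + ((a ⊓ b) ⊓ (d ⊓ c)) * p)  ≡⟨ cong (λ n → q ^ (a + b) * (q + ((a ⊓ b) ⊓ n) * p)) (ℕ.⊓-comm d c) ⟩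
      q ^ (a + b) * (q + ((a ⊓ b) ⊓ (c ⊓ d)) * p)  ∎

    #monic-closed : ∀ a b c d → a + b ≡ c + d → Closed a b c d
    #monic-closed a b c d a+b≡c+d with ℕ.≤-total a b | ℕ.≤-total c d
    ... | inj₁ a≤b | inj₁ c≤d = Closed-sorted a b c d a+b≡c+d a≤b c≤d
    ... | inj₁ a≤b | inj₂ d≤c = Closed-swapʳ a b c d a+b≡c+d (Closed-sorted a b d c (trans a+b≡c+d (+-comm c d)) a≤b d≤c)
    ... | inj₂ b≤a | inj₁ c≤d = Closed-swapˡ a b c d (Closed-sorted b a c d (trans (+-comm b a) a+b≡c+d) b≤a c≤d)
    ... | inj₂ b≤a | inj₂ d≤c = Closed-swapˡ a b c d (Closed-swapʳ b a c d (trans (+-comm b a) a+b≡c+d)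
      (Closed-sorted b a d c (trans (+-comm b a) (trans a+b≡c+d (+-comm c d))) b≤a d≤c))

    -- Divisor counts by degree, summed singly and in pairs

    #divisors : ∀ {m} → ℕ → Monic m → ℕ
    #divisors k s = ∑ (𝓜 k) λ d → divides d (poly s)

    -- The only monic polynomial of degree 0 is 1, so this is the count with e = 1.
    ∑-#divisors : ∀ m k → ∑ (𝓜 m) (#divisors k) ≡ #monic m 0 k
    ∑-#divisors m k = begin
      ∑ (𝓜 m) (λ s → ∑ (𝓜 k) λ d → divides d (poly s))  ≡⟨ ∑-swap (𝓜 m) (𝓜 k) _ ⟩
      ∑ (𝓜 k) (λ d → ∑ (𝓜 m) λ s → divides d (poly s))
        ≡⟨ ∑-cong (𝓜 k) (λ d → ∑-cong (𝓜 m) λ s → divides-resp d (P.sym (P.*-identityʳ (poly s)))) ⟩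
      ∑ (𝓜 k) (λ d → ∑ (𝓜 m) λ s → divides d (poly s *ₚ 1ₚ))  ≡⟨ +-identityʳ _ ⟨
      #monic m 0 k                                            ∎

    -- The condition f ∣ s is opened into a sum over cofactors e with s = e f. The sum over s then
    -- has the single term s = f e, leaving the condition d ∣ f e.
    ∑-#divisors² : ∀ a b c → ∑ (𝓜 (a + b)) (λ s → #divisors a s * #divisors c s) ≡ #monic a b c
    ∑-#divisors² a b c = begin
      ∑ (𝓜 (a + b)) (λ s → #divisors a s * #divisors c s)
        ≡⟨ ∑-cong (𝓜 (a + b)) expand ⟩
      (∑ (𝓜 (a + b)) λ s → ∑ (𝓜 a) λ f → ∑ (𝓜 b) λ e → ∑ (𝓜 c) λ d → 𝟙 (does (poly s ≋? poly e *ₚ poly f)) * divides d (poly s))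
        ≡⟨ ∑-reverse₄ (𝓜 (a + b)) (𝓜 a) (𝓜 b) (𝓜 c) _ ⟩
      (∑ (𝓜 c) λ d → ∑ (𝓜 b) λ e → ∑ (𝓜 a) λ f → ∑ (𝓜 (a + b)) λ s → 𝟙 (does (poly s ≋? poly e *ₚ poly f)) * divides d (poly s))
        ≡⟨ ∑-swap (𝓜 c) (𝓜 b) _ ⟩
      (∑ (𝓜 b) λ e → ∑ (𝓜 c) λ d → ∑ (𝓜 a) λ f → ∑ (𝓜 (a + b)) λ s → 𝟙 (does (poly s ≋? poly e *ₚ poly f)) * divides d (poly s))
        ≡⟨ ∑-cong (𝓜 b) (λ e → ∑-cong (𝓜 c) λ d → ∑-cong (𝓜 a) λ f → contract e d f) ⟩
      #monic a b c ∎
      where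
      expand : ∀ s → #divisors a s * #divisors c s ≡
        ∑ (𝓜 a) λ f → ∑ (𝓜 b) λ e → ∑ (𝓜 c) λ d → 𝟙 (does (poly s ≋? poly e *ₚ poly f)) * divides d (poly s)
      expand s = begin
        #divisors a s * #divisors c s
          ≡⟨ ∑-distribʳ-* (𝓜 a) _ (#divisors c s) ⟨
        ∑ (𝓜 a) (λ f → divides f (poly s) * #divisors c s)
          ≡⟨ ∑-cong (𝓜 a) (λ f → cong (_* #divisors c s) (∑-cofactors f b (subst (λ n → IsMonic n (poly s)) (+-comm a b) (poly-IsMonic s)))) ⟨
        ∑ (𝓜 a) (λ f → ∑ (𝓜 b) (λ e → 𝟙 (does (poly s ≋? poly e *ₚ poly f))) * #divisors c s)
          ≡⟨ ∑-cong (𝓜 a) (λ f → trans (sym (∑-distribʳ-* (𝓜 b) _ (#divisors c s)))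
               (∑-cong (𝓜 b) λ e → sym (∑-distribˡ-* (𝓜 c) (𝟙 (does (poly s ≋? poly e *ₚ poly f))) _))) ⟩
        (∑ (𝓜 a) λ f → ∑ (𝓜 b) λ e → ∑ (𝓜 c) λ d → 𝟙 (does (poly s ≋? poly e *ₚ poly f)) * divides d (poly s)) ∎
      contract : ∀ e d f → ∑ (𝓜 (a + b)) (λ s → 𝟙 (does (poly s ≋? poly e *ₚ poly f)) * divides d (poly s)) ≡ divides d (poly f *ₚ poly e)
      contract e d f = begin
        ∑ (𝓜 (a + b)) (λ s → 𝟙 (does (poly s ≋? poly e *ₚ poly f)) * divides d (poly s))
          ≡⟨ ∑-cong (𝓜 (a + b)) (λ s → cong (_* divides d (poly s)) (𝟙-⇔ (poly s ≋? poly e *ₚ poly f) (poly f *ₚ poly e ≋? poly s)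
               (λ eq → P.sym (P.trans eq (P.*-comm (poly e) (poly f)))) (λ eq → P.sym (P.trans (P.*-comm (poly e) (poly f)) eq)))) ⟩
        ∑ (𝓜 (a + b)) (λ s → 𝟙 (does (poly f *ₚ poly e ≋? poly s)) * divides d (poly s))
          ≡⟨ ∑-𝓜-δ (a + b) (IsMonic-* (poly-IsMonic e) a (poly-IsMonic f)) (divides-resp d) ⟩
        divides d (poly f *ₚ poly e) ∎

  length-filterᵇ : ∀ (p : A → Bool) xs → length (filterᵇ p xs) ≡ ∑ xs (𝟙 ∘ p)
  length-filterᵇ p []       = refl
  length-filterᵇ p (x ∷ xs) with p x
  ... | true  = cong suc (length-filterᵇ p xs)
  ... | false = length-filterᵇ p xs

  -- When there is at most one hit, the number of hits determines whether one exists. Uniqueness of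
  -- cofactors puts the search in `divides?` into this situation.
  any-∑ : ∀ (p : A → Bool) xs b → ∑ xs (𝟙 ∘ p) ≡ 𝟙 b → any p xs ≡ b
  any-∑ p []       false _  = refl
  any-∑ p (x ∷ xs) b     eq with p x
  any-∑ p (x ∷ xs) true  eq | true  = refl
  any-∑ p (x ∷ xs) b     eq | false = any-∑ p xs b eq

  ∑-downFrom-cong : ∀ n {f g} → (∀ k → k < n → f k ≡ g k) → ∑ (downFrom n) f ≡ ∑ (downFrom n) g
  ∑-downFrom-cong zero    f≗g = refl
  ∑-downFrom-cong (suc n) f≗g = cong₂ _+_ (f≗g n ℕ.≤-refl) (∑-downFrom-cong n λ k k<n → f≗g k (ℕ.m≤n⇒m≤1+n k<n))

  ∑-downFrom-first : ∀ n f → ∑ (downFrom (suc n)) f ≡ ∑ (downFrom n) (f ∘ suc) + f 0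
  ∑-downFrom-first zero    f = +-comm (f 0) 0
  ∑-downFrom-first (suc n) f = trans (cong (f (suc n) +_) (∑-downFrom-first n f)) (sym (+-assoc (f (suc n)) _ _))

  ∑-downFrom-inner : ∀ n f → f 0 ≡ 0 → f (suc n) ≡ 0 → ∑ (downFrom (2 + n)) f ≡ ∑ (downFrom n) (f ∘ suc)
  ∑-downFrom-inner n f f0≡0 fn≡0 = begin
    f (suc n) + ∑ (downFrom (suc n)) f  ≡⟨ cong (_+ ∑ (downFrom (suc n)) f) fn≡0 ⟩
    ∑ (downFrom (suc n)) f              ≡⟨ ∑-downFrom-first n f ⟩
    ∑ (downFrom n) (f ∘ suc) + f 0      ≡⟨ trans (cong (∑ (downFrom n) (f ∘ suc) +_) f0≡0) (+-identityʳ _) ⟩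
    ∑ (downFrom n) (f ∘ suc)            ∎

  square-∑ : ∀ (xs : List A) f → ∑ xs f * ∑ xs f ≡ ∑ xs (λ x → ∑ xs λ y → f x * f y)
  square-∑ xs f = sym (trans (∑-cong xs λ x → ∑-distribˡ-* xs (f x) f) (∑-distribʳ-* xs f (∑ xs f)))

  -- The sum of minima as a binomial coefficient

  -- The smaller of the degrees of a divisor and of its cofactor.
  τ : ℕ → ℕ → ℕ
  τ m a = a ⊓ (m ∸ a)

  ∑∑⊓ : ℕ → ℕ
  ∑∑⊓ m = ∑ (downFrom (suc m)) λ a → ∑ (downFrom (suc m)) λ c → τ m a ⊓ τ m c

  τ-last : ∀ m → τ m m ≡ 0
  τ-last m = trans (cong (m ⊓_) (ℕ.n∸n≡0 m)) (ℕ.⊓-zeroʳ m)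

  τ-suc : ∀ {m a} → a ≤ m → τ (2 + m) (suc a) ≡ suc (τ m a)
  τ-suc {m} {a} a≤m = cong (suc a ⊓_) (ℕ.+-∸-assoc 1 a≤m)

  -- On the border of the index square, where a or c is 0 or m + 2, the minimum is 0. Inside,
  -- lowering both indices by one and m + 2 to m lowers every minimum by exactly 1, and there are (m
  -- + 1)² inner terms.
  ∑∑⊓-suc-suc : ∀ m → ∑∑⊓ (2 + m) ≡ suc m * suc m + ∑∑⊓ m
  ∑∑⊓-suc-suc m = begin
    ∑∑⊓ (2 + m)
      ≡⟨ ∑-downFrom-inner (suc m) (λ a → ∑ (downFrom (3 + m)) λ c → τ (2 + m) a ⊓ τ (2 + m) c) (∑-zero (downFrom (3 + m)))
           (trans (∑-cong (downFrom (3 + m)) λ c → cong (_⊓ τ (2 + m) c) (τ-last (2 + m))) (∑-zero (downFrom (3 + m)))) ⟩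
    ∑ R (λ a → ∑ (downFrom (3 + m)) λ c → τ (2 + m) (suc a) ⊓ τ (2 + m) c)
      ≡⟨ ∑-cong R (λ a → ∑-downFrom-inner (suc m) (λ c → τ (2 + m) (suc a) ⊓ τ (2 + m) c) (ℕ.⊓-zeroʳ (τ (2 + m) (suc a)))
           (trans (cong (τ (2 + m) (suc a) ⊓_) (τ-last (2 + m))) (ℕ.⊓-zeroʳ (τ (2 + m) (suc a))))) ⟩
    ∑ R (λ a → ∑ R λ c → τ (2 + m) (suc a) ⊓ τ (2 + m) (suc c))
      ≡⟨ ∑-downFrom-cong (suc m) (λ { a (s≤s a≤m) → ∑-downFrom-cong (suc m) λ { c (s≤s c≤m) → cong₂ _⊓_ (τ-suc a≤m) (τ-suc c≤m) } }) ⟩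
    ∑ R (λ a → ∑ R λ c → 1 + τ m a ⊓ τ m c)
      ≡⟨ ∑-cong R (λ a → trans (∑-distrib-+ R (λ _ → 1) _)
           (cong (_+ ∑ R (λ c → τ m a ⊓ τ m c)) (trans (∑-const R 1) (trans (*-identityʳ _) (length-downFrom (suc m)))))) ⟩
    ∑ R (λ a → suc m + ∑ R λ c → τ m a ⊓ τ m c)
      ≡⟨ ∑-distrib-+ R (λ _ → suc m) _ ⟩
    ∑ R (λ _ → suc m) + ∑∑⊓ m
      ≡⟨ cong (_+ ∑∑⊓ m) (trans (∑-const R (suc m)) (cong (_* suc m) (length-downFrom (suc m)))) ⟩
    suc m * suc m + ∑∑⊓ m ∎
    where R = downFrom (suc m)

  pascal : ∀ n k → suc n C suc k ≡ n C k + n C suc k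
  pascal n k = sym (nCk+nC[k+1]≡[n+1]C[k+1] n k)

  -- Two consecutive triangular numbers add up to a square. By Pascal's rule their sum is also the
  -- increment of `(1 + n) C 3` when n grows by 2, the step of the recursion for `∑∑⊓`.
  C₂+C₂≡square : ∀ n → (2 + n) C 2 + (1 + n) C 2 ≡ suc n * suc n
  C₂+C₂≡square zero    = refl
  C₂+C₂≡square (suc n) = begin
    (3 + n) C 2 + (2 + n) C 2  ≡⟨ cong₂ _+_ (pascal (2 + n) 1) (pascal (1 + n) 1) ⟩
    ((2 + n) C 1 + (2 + n) C 2) + ((1 + n) C 1 + (1 + n) C 2)
      ≡⟨ cong₂ (λ x y → (x + (2 + n) C 2) + (y + (1 + n) C 2)) (nC1≡n (2 + n)) (nC1≡n (1 + n)) ⟩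
    ((2 + n) + (2 + n) C 2) + ((1 + n) + (1 + n) C 2)  ≡⟨ interchange (2 + n) _ (1 + n) _ ⟩
    ((2 + n) + (1 + n)) + ((2 + n) C 2 + (1 + n) C 2)  ≡⟨ cong (((2 + n) + (1 + n)) +_) (C₂+C₂≡square n) ⟩
    ((2 + n) + (1 + n)) + suc n * suc n                ≡⟨ expand n ⟩
    suc (suc n) * suc (suc n)                          ∎
    where
    expand : ∀ n → ((2 + n) + (1 + n)) + (1 + n) * (1 + n) ≡ (2 + n) * (2 + n)
    expand = solve-∀

  ∑∑⊓≡C₃ : ∀ m → ∑∑⊓ m ≡ suc m C 3
  ∑∑⊓≡C₃ zero          = refl
  ∑∑⊓≡C₃ (suc zero)    = refl
  ∑∑⊓≡C₃ (suc (suc m)) = begin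
    ∑∑⊓ (2 + m)                                ≡⟨ ∑∑⊓-suc-suc m ⟩
    suc m * suc m + ∑∑⊓ m                      ≡⟨ cong₂ _+_ (sym (C₂+C₂≡square m)) (∑∑⊓≡C₃ m) ⟩
    (2 + m) C 2 + (1 + m) C 2 + (1 + m) C 3    ≡⟨ +-assoc ((2 + m) C 2) _ _ ⟩
    (2 + m) C 2 + ((1 + m) C 2 + (1 + m) C 3)  ≡⟨ cong ((2 + m) C 2 +_) (pascal (1 + m) 2) ⟨
    (2 + m) C 2 + (2 + m) C 3                  ≡⟨ pascal (2 + m) 2 ⟨
    (3 + m) C 3                                ∎

  -- The first two power sums of the divisor function

  module Moments (F : FiniteField) where
    open FiniteField F using (_≟_) renaming (card to q)
    open Poly F using (_+ₚ_; _*ₚ_; _==_; Monic; poly; 𝓜; divides?; Φ)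
    open PolynomialRing F
    open Divisibility F
    open Sums F
    open Counting F

    length-+ₚ : ∀ f g → length (f +ₚ g) ≡ length f ⊔ length g
    length-+ₚ []      g       = refl
    length-+ₚ (a ∷ f) []      = refl
    length-+ₚ (a ∷ f) (b ∷ g) = cong suc (length-+ₚ f g)

    -- `_==_` is false on lists of different lengths. It agrees with `≋` on the products in
    -- `divides?` because they carry no surplus trailing zeros.
    length-*ₚ : ∀ f g {m n} → length f ≡ suc m → length g ≡ suc n → length (f *ₚ g) ≡ suc (m + n)
    length-*ₚ (a ∷ [])     (b ∷ g) refl refl = cong suc
      (trans (length-+ₚ (map (a K.*_) g) []) (trans (ℕ.⊔-identityʳ _) (length-map _ g)))
    length-*ₚ (a ∷ f@(_ ∷ f′)) (b ∷ g) refl refl = cong suc (begin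
      length (map (a K.*_) g +ₚ f *ₚ (b ∷ g))          ≡⟨ length-+ₚ (map (a K.*_) g) _ ⟩
      length (map (a K.*_) g) ⊔ length (f *ₚ (b ∷ g))  ≡⟨ cong₂ _⊔_ (length-map _ g) (length-*ₚ f (b ∷ g) refl refl) ⟩
      length g ⊔ suc (length f′ + length g)            ≡⟨ ℕ.m≤n⇒m⊔n≡n (ℕ.m≤n+m (length g) (length f)) ⟩
      suc (length f′ + length g)                       ∎)

    length-poly : ∀ {n} (v : Monic n) → length (poly v) ≡ suc n
    length-poly v = trans (length-++ (toList v)) (trans (+-comm _ 1) (cong suc (length-toList v)))

    ==≡does : ∀ f g → length f ≡ length g → (f == g) ≡ does (f ≋? g)
    ==≡does []      []      _  = sym (dec-true ([] ≋? []) P.refl)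
    ==≡does (a ∷ f) (b ∷ g) eq = trans (cong (does (a ≟ b) ∧_) (==≡does f g (ℕ.suc-injective eq)))
      (does-⇔ (mk⇔ (λ (p , r) → ∷-cong p r) ∷-injective) (a ≟ b ×-dec f ≋? g) (a ∷ f ≋? b ∷ g))

    divides?≡does : ∀ {k m} (d : Monic k) (s : Monic m) → k ≤ m → divides? d s ≡ does (d ∣? poly s)
    divides?≡does {k} {m} d s k≤m = any-∑ _ (𝓜 (m ∸ k)) _ (begin
      ∑ (𝓜 (m ∸ k)) (λ e → 𝟙 ((poly d *ₚ poly e) == poly s))
        ≡⟨ ∑-cong (𝓜 (m ∸ k)) (λ e → trans
             (cong 𝟙 (==≡does (poly d *ₚ poly e) (poly s) (trans (length-*ₚ (poly d) (poly e) (length-poly d) (length-poly e))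
               (trans (cong suc (ℕ.m+[n∸m]≡n k≤m)) (sym (length-poly s))))))
             (𝟙-⇔ (poly d *ₚ poly e ≋? poly s) (poly s ≋? poly e *ₚ poly d)
               (λ de≋s → P.trans (P.sym de≋s) (P.*-comm (poly d) (poly e)))
               (λ s≋ed → P.trans (P.*-comm (poly d) (poly e)) (P.sym s≋ed)))) ⟩
      ∑ (𝓜 (m ∸ k)) (λ e → 𝟙 (does (poly s ≋? poly e *ₚ poly d)))
        ≡⟨ ∑-cofactors d (m ∸ k) (subst (λ n → IsMonic n (poly s)) (sym (ℕ.m∸n+n≡m k≤m)) (poly-IsMonic s)) ⟩
      𝟙 (does (d ∣? poly s)) ∎)

    divisorsOfDegree : ∀ {m} → ℕ → Monic m → ℕ
    divisorsOfDegree k s = length (filterᵇ (λ d → divides? d s) (𝓜 k))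

    divisorsOfDegree≡#divisors : ∀ {k m} (s : Monic m) → k ≤ m → divisorsOfDegree k s ≡ #divisors k s
    divisorsOfDegree≡#divisors {k} s k≤m = trans (length-filterᵇ (λ d → divides? d s) (𝓜 k))
      (∑-cong (𝓜 k) λ d → cong 𝟙 (divides?≡does d s k≤m))

    ≤⇒≤ᵇ≡true : ∀ {m n} → m ≤ n → (m ≤ᵇ n) ≡ true
    ≤⇒≤ᵇ≡true {m} {n} m≤n with m ≤ᵇ n | ℕ.≤⇒≤ᵇ m≤n
    ... | true | _ = refl

    -- Φ is defined by a local recursion that cannot be named from outside; partialΦ is that
    -- recursion, found by unification once the degree m of s and the recursion argument are
    -- abstracted into distinct variables.
    mutual
      partialΦ : (m : ℕ) → Monic m → ℕ → ℕ
      partialΦ = _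

      Φ-suc : ∀ m (s : Monic (suc m)) → Φ s ≡ divisorsOfDegree (suc m) s + partialΦ (suc m) s m
      Φ-suc m s with suc m ≤ᵇ suc m | ℕ.≤⇒≤ᵇ {suc m} ℕ.≤-refl
      ... | true | _ with divisorsOfDegree (suc m) s
      ... | _ with suc m | s
      ... | _ | _ = refl

    partialΦ≡∑#divisors : ∀ m (s : Monic m) k → k ≤ m → partialΦ m s k ≡ ∑ (downFrom (suc k)) λ j → #divisors j s
    partialΦ≡∑#divisors m s zero    k≤m = trans (divisorsOfDegree≡#divisors s z≤n) (sym (+-identityʳ _))
    partialΦ≡∑#divisors m s (suc k) k<m rewrite ≤⇒≤ᵇ≡true k<m =
      cong₂ _+_ (divisorsOfDegree≡#divisors s k<m) (partialΦ≡∑#divisors m s k (ℕ.<⇒≤ k<m))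

    Φ≡∑#divisors : ∀ {m} (s : Monic m) → Φ s ≡ ∑ (downFrom (suc m)) λ k → #divisors k s
    Φ≡∑#divisors {m} s = partialΦ≡∑#divisors m s m ℕ.≤-refl

    q-cancel : ∀ {m n} → q * m ≡ q * n → m ≡ n
    q-cancel = ℕ.*-cancelˡ-≡ _ _ q {{card-nonZero F}}

    -- Each of the m + 1 degrees contributes q^m: the factor e = 1 has degree 0, so the minimum in
    -- the closed form vanishes.
    ∑-Φ : ∀ m → ∑ (𝓜 m) Φ ≡ q ^ m * suc m
    ∑-Φ m = q-cancel (begin
      q * ∑ (𝓜 m) Φ                          ≡⟨ cong (q *_) (trans (∑-cong (𝓜 m) Φ≡∑#divisors) (∑-swap (𝓜 m) R _)) ⟩
      q * ∑ R (λ k → ∑ (𝓜 m) (#divisors k))  ≡⟨ ∑-distribˡ-* R q _ ⟨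
      ∑ R (λ k → q * ∑ (𝓜 m) (#divisors k))  ≡⟨ ∑-downFrom-cong (suc m) (λ { k (s≤s k≤m) → term k k≤m }) ⟩
      ∑ R (λ _ → q ^ m * q)                  ≡⟨ trans (∑-const R _) (cong (_* (q ^ m * q)) (length-downFrom (suc m))) ⟩
      suc m * (q ^ m * q)                    ≡⟨ rearrange (suc m) (q ^ m) q ⟩
      q * (q ^ m * suc m)                    ∎)
      where
      R = downFrom (suc m)
      rearrange : ∀ x y z → x * (y * z) ≡ z * (y * x)
      rearrange = solve-∀
      term : ∀ k → k ≤ m → q * ∑ (𝓜 m) (#divisors k) ≡ q ^ m * q
      term k k≤m = begin
        q * ∑ (𝓜 m) (#divisors k)  ≡⟨ cong (q *_) (∑-#divisors m k) ⟩
        q * #monic m 0 k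
          ≡⟨ #monic-closed m 0 k (m ∸ k) (trans (+-identityʳ m) (sym (ℕ.m+[n∸m]≡n k≤m))) ⟩
        q ^ (m + 0) * (q + ((m ⊓ 0) ⊓ (k ⊓ (m ∸ k))) * p)
          ≡⟨ cong₂ (λ n t → q ^ n * (q + (t ⊓ (k ⊓ (m ∸ k))) * p)) (+-identityʳ m) (ℕ.⊓-zeroʳ m) ⟩
        q ^ m * (q + 0)  ≡⟨ cong (q ^ m *_) (+-identityʳ q) ⟩
        q ^ m * q        ∎

    -- Squaring the sum over degrees gives all pairs (a, c), and `#monic-closed` evaluates each pair
    -- with the minimum of a, m - a, c and m - c.
    ∑-Φ² : ∀ m → q * ∑ (𝓜 m) (λ s → Φ s * Φ s) ≡ q ^ m * (suc m * suc m * q + ∑∑⊓ m * p)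
    ∑-Φ² m = begin
      q * ∑ (𝓜 m) (λ s → Φ s * Φ s)
        ≡⟨ cong (q *_) (∑-cong (𝓜 m) λ s → trans (cong₂ _*_ (Φ≡∑#divisors s) (Φ≡∑#divisors s)) (square-∑ R (λ k → #divisors k s))) ⟩
      q * ∑ (𝓜 m) (λ s → ∑ R λ a → ∑ R λ c → #divisors a s * #divisors c s)
        ≡⟨ cong (q *_) (trans (∑-swap (𝓜 m) R _) (∑-cong R λ a → ∑-swap (𝓜 m) R _)) ⟩
      q * ∑ R (λ a → ∑ R λ c → ∑ (𝓜 m) λ s → #divisors a s * #divisors c s)
        ≡⟨ trans (∑-cong R λ a → ∑-distribˡ-* R q _) (∑-distribˡ-* R q _) ⟨
      ∑ R (λ a → ∑ R λ c → q * ∑ (𝓜 m) λ s → #divisors a s * #divisors c s)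
        ≡⟨ ∑-downFrom-cong (suc m) (λ { a (s≤s a≤m) → ∑-downFrom-cong (suc m) λ { c (s≤s c≤m) → term a c a≤m c≤m } }) ⟩
      ∑ R (λ a → ∑ R λ c → q ^ m * (q + (τ m a ⊓ τ m c) * p))
        ≡⟨ trans (∑-cong R λ a → ∑-distribˡ-* R (q ^ m) _) (∑-distribˡ-* R (q ^ m) _) ⟩
      q ^ m * ∑ R (λ a → ∑ R λ c → q + (τ m a ⊓ τ m c) * p)
        ≡⟨ cong (q ^ m *_) (trans (∑-cong R λ a → trans (∑-distrib-+ R (λ _ → q) _)
               (cong₂ _+_ (∑R-const q) (∑-distribʳ-* R (λ c → τ m a ⊓ τ m c) p)))
             (trans (∑-distrib-+ R (λ _ → suc m * q) _)
               (cong₂ _+_ (trans (∑R-const _) (sym (*-assoc (suc m) (suc m) q))) (∑-distribʳ-* R (λ a → ∑ R λ c → τ m a ⊓ τ m c) p)))) ⟩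
      q ^ m * (suc m * suc m * q + ∑∑⊓ m * p) ∎
      where
      R = downFrom (suc m)
      ∑R-const : ∀ n → ∑ R (λ _ → n) ≡ suc m * n
      ∑R-const n = trans (∑-const R n) (cong (_* n) (length-downFrom (suc m)))
      ∑-#divisors²′ : ∀ a b c {m} → a + b ≡ m → ∑ (𝓜 m) (λ s → #divisors a s * #divisors c s) ≡ #monic a b c
      ∑-#divisors²′ a b c refl = ∑-#divisors² a b c
      term : ∀ a c → a ≤ m → c ≤ m → q * ∑ (𝓜 m) (λ s → #divisors a s * #divisors c s) ≡ q ^ m * (q + (τ m a ⊓ τ m c) * p)
      term a c a≤m c≤m = begin
        q * ∑ (𝓜 m) (λ s → #divisors a s * #divisors c s)  ≡⟨ cong (q *_) (∑-#divisors²′ a (m ∸ a) c (ℕ.m+[n∸m]≡n a≤m)) ⟩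
        q * #monic a (m ∸ a) c
          ≡⟨ #monic-closed a (m ∸ a) c (m ∸ c) (trans (ℕ.m+[n∸m]≡n a≤m) (sym (ℕ.m+[n∸m]≡n c≤m))) ⟩
        q ^ (a + (m ∸ a)) * (q + (τ m a ⊓ τ m c) * p)  ≡⟨ cong (λ n → q ^ n * (q + (τ m a ⊓ τ m c) * p)) (ℕ.m+[n∸m]≡n a≤m) ⟩
        q ^ m * (q + (τ m a ⊓ τ m c) * p)              ∎

    length-𝓜 : ∀ m → length (𝓜 m) ≡ q ^ m
    length-𝓜 m = trans (sym (trans (∑-const (𝓜 m) 1) (*-identityʳ _))) (trans (∑-allVecs-const m 1) (*-identityʳ _))

-- From sums of natural numbers to rational mean and variance

module _ where
  open import Algebra.Properties.AbelianGroup ℚ.+-0-abelianGroup using (xyx⁻¹≈y)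
  open import Algebra.Properties.Group ℚ.+-0-group using (⁻¹-anti-homo-//; ⁻¹-involutive)
  open import Data.Integer.Base as ℤ using (+_)
  import Data.Integer.Properties as ℤ
  open import Data.List.Properties using (length-map; map-cong)
  open import Data.Nat.Base using (_+_; _*_; _∸_; NonZero)
  open import Data.Nat.Tactic.RingSolver using (solve-∀)
  open import Data.Rational.Base as ℚ using (ℚ; _/_; toℚᵘ)
  open import Data.Rational.Unnormalised.Base as ℚᵘ using (mkℚᵘ; *≡*) renaming (_≃_ to _≃ᵘ_)
  import Data.Rational.Unnormalised.Properties as ℚᵘ
  open import Relation.Binary.PropositionalEquality using (_≡_; refl; sym; trans; cong; cong₂; module ≡-Reasoning)
  open import Relation.Binary.Reasoning.Setoid ℚᵘ.≃-setoid using (step-≈-⟩; step-≈-⟨) renaming (begin_ to begin≃_; _∎ to _≃∎)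
  open ≡-Reasoning

  private variable
    A : Set

  toℚᵘ-/ : ∀ i n .{{_ : NonZero n}} → toℚᵘ (i / n) ≃ᵘ i ℚᵘ./ n
  toℚᵘ-/ i (suc n) = ℚ.toℚᵘ-fromℚᵘ (mkℚᵘ i n)

  fromℕ : ℕ → ℚ
  fromℕ n = + n / 1

  fromℕ-+ : ∀ m n → fromℕ (m + n) ≡ fromℕ m ℚ.+ fromℕ n
  fromℕ-+ m n = ℚ.toℚᵘ-injective (begin≃
    toℚᵘ (fromℕ (m + n))                ≈⟨ toℚᵘ-/ (+ (m + n)) 1 ⟩
    + (m + n) ℚᵘ./ 1                    ≈⟨ *≡* (cong (ℤ._* + 1) (cong₂ ℤ._+_ (sym (ℤ.*-identityʳ (+ m))) (sym (ℤ.*-identityʳ (+ n))))) ⟩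
    (+ m ℚᵘ./ 1) ℚᵘ.+ (+ n ℚᵘ./ 1)      ≈⟨ ℚᵘ.+-cong (toℚᵘ-/ (+ m) 1) (toℚᵘ-/ (+ n) 1) ⟨
    toℚᵘ (fromℕ m) ℚᵘ.+ toℚᵘ (fromℕ n)  ≈⟨ ℚ.toℚᵘ-homo-+ (fromℕ m) (fromℕ n) ⟨
    toℚᵘ (fromℕ m ℚ.+ fromℕ n)          ≃∎)

  -- Rationals are stored in lowest terms; among unnormalised fractions the equality is plain cross
  -- multiplication, which is the hypothesis.
  /-*-/ : ∀ a b c d k .{{_ : NonZero b}} .{{_ : NonZero d}} → a * d ≡ c * k * b → fromℕ a ℚ.* (+ 1 / b) ≡ (+ c / d) ℚ.* fromℕ k
  /-*-/ a b@(suc _) c d@(suc _) k ad≡ckb = ℚ.toℚᵘ-injective (begin≃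
    toℚᵘ (fromℕ a ℚ.* (+ 1 / b))        ≈⟨ ℚ.toℚᵘ-homo-* (fromℕ a) (+ 1 / b) ⟩
    toℚᵘ (fromℕ a) ℚᵘ.* toℚᵘ (+ 1 / b)  ≈⟨ ℚᵘ.*-cong (toℚᵘ-/ (+ a) 1) (toℚᵘ-/ (+ 1) b) ⟩
    (+ a ℚᵘ./ 1) ℚᵘ.* (+ 1 ℚᵘ./ b)      ≈⟨ *≡* cross ⟩
    (+ c ℚᵘ./ d) ℚᵘ.* (+ k ℚᵘ./ 1)      ≈⟨ ℚᵘ.*-cong (toℚᵘ-/ (+ c) d) (toℚᵘ-/ (+ k) 1) ⟨
    toℚᵘ (+ c / d) ℚᵘ.* toℚᵘ (fromℕ k)  ≈⟨ ℚ.toℚᵘ-homo-* (+ c / d) (fromℕ k) ⟨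
    toℚᵘ ((+ c / d) ℚ.* fromℕ k)        ≃∎)
    where
    cross : (+ a ℤ.* + 1) ℤ.* + (d * 1) ≡ (+ c ℤ.* + k) ℤ.* + (1 * b)
    cross = begin
      (+ a ℤ.* + 1) ℤ.* + (d * 1)  ≡⟨ cong₂ ℤ._*_ (ℤ.*-identityʳ (+ a)) (cong +_ (ℕ.*-identityʳ d)) ⟩
      + a ℤ.* + d                  ≡⟨ ℤ.pos-* a d ⟨
      + (a * d)                    ≡⟨ cong +_ ad≡ckb ⟩
      + (c * k * b)                ≡⟨ ℤ.pos-* (c * k) b ⟩
      + (c * k) ℤ.* + b            ≡⟨ cong₂ ℤ._*_ (ℤ.pos-* c k) (cong +_ (sym (ℕ.*-identityˡ b))) ⟩
      (+ c ℤ.* + k) ℤ.* + (1 * b)  ∎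

  fromℕ-* : ∀ m n → fromℕ (m * n) ≡ fromℕ m ℚ.* fromℕ n
  fromℕ-* m n = trans (sym (ℚ.*-identityʳ (fromℕ (m * n)))) (/-*-/ (m * n) 1 m 1 n refl)

  sumℚ-fromℕ : ∀ (xs : List A) f → sumℚ (map (fromℕ ∘ f) xs) ≡ fromℕ (∑ xs f)
  sumℚ-fromℕ []       f = refl
  sumℚ-fromℕ (x ∷ xs) f = trans (cong (fromℕ (f x) ℚ.+_) (sumℚ-fromℕ xs f)) (sym (fromℕ-+ (f x) (∑ xs f)))

  mean-nonEmpty : ∀ xs {n} .{{_ : NonZero n}} → length xs ≡ n → mean xs ≡ sumℚ xs ℚ.* (+ 1 / n)
  mean-nonEmpty xs {suc n} eq with length xs
  mean-nonEmpty xs {suc n} refl | _ = refl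

  𝔼-fromℕ : ∀ (xs : List A) f {n} .{{_ : NonZero n}} → length xs ≡ n → 𝔼 xs (fromℕ ∘ f) ≡ fromℕ (∑ xs f) ℚ.* (+ 1 / n)
  𝔼-fromℕ xs f {n} eq = trans (mean-nonEmpty (map (fromℕ ∘ f) xs) (trans (length-map _ xs) eq)) (cong (ℚ._* (+ 1 / n)) (sumℚ-fromℕ xs f))

  fromℕ-sub : ∀ m k → fromℕ (m + k) ℚ.- fromℕ m ≡ fromℕ k
  fromℕ-sub m k = begin
    fromℕ (m + k) ℚ.- fromℕ m        ≡⟨ cong (ℚ._- fromℕ m) (fromℕ-+ m k) ⟩
    fromℕ m ℚ.+ fromℕ k ℚ.- fromℕ m  ≡⟨ xyx⁻¹≈y (fromℕ m) (fromℕ k) ⟩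
    fromℕ k                          ∎

  -- A square does not see the sign, so the squared deviation is the image of a natural number and
  -- the variance can be summed in the natural numbers.
  square-sub : ∀ a b → (fromℕ a ℚ.- fromℕ b) ℚ.* (fromℕ a ℚ.- fromℕ b) ≡ fromℕ (ℕ.∣ a - b ∣ * ℕ.∣ a - b ∣)
  square-sub a b with ℕ.≤-total b a
  ... | inj₁ b≤a = begin
    (fromℕ a ℚ.- fromℕ b) ℚ.* (fromℕ a ℚ.- fromℕ b)
      ≡⟨ cong (λ x → x ℚ.* x) (trans (cong (λ n → fromℕ n ℚ.- fromℕ b) (sym (ℕ.m+[n∸m]≡n b≤a))) (fromℕ-sub b (a ∸ b))) ⟩
    fromℕ (a ∸ b) ℚ.* fromℕ (a ∸ b)    ≡⟨ fromℕ-* (a ∸ b) (a ∸ b) ⟨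
    fromℕ ((a ∸ b) * (a ∸ b))          ≡⟨ cong (λ n → fromℕ (n * n)) (ℕ.m≤n⇒∣n-m∣≡n∸m b≤a) ⟨
    fromℕ (ℕ.∣ a - b ∣ * ℕ.∣ a - b ∣)  ∎
  ... | inj₂ a≤b = begin
    (fromℕ a ℚ.- fromℕ b) ℚ.* (fromℕ a ℚ.- fromℕ b)  ≡⟨ cong (λ x → x ℚ.* x) (sym (⁻¹-anti-homo-// (fromℕ b) (fromℕ a))) ⟩
    (ℚ.- (fromℕ b ℚ.- fromℕ a)) ℚ.* (ℚ.- (fromℕ b ℚ.- fromℕ a))
      ≡⟨ cong (λ x → (ℚ.- x) ℚ.* (ℚ.- x)) (trans (cong (λ n → fromℕ n ℚ.- fromℕ a) (sym (ℕ.m+[n∸m]≡n a≤b))) (fromℕ-sub a (b ∸ a))) ⟩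
    (ℚ.- fromℕ (b ∸ a)) ℚ.* (ℚ.- fromℕ (b ∸ a))  ≡⟨ -x*-y≈x*y (fromℕ (b ∸ a)) (fromℕ (b ∸ a)) ⟩
    fromℕ (b ∸ a) ℚ.* fromℕ (b ∸ a)              ≡⟨ fromℕ-* (b ∸ a) (b ∸ a) ⟨
    fromℕ ((b ∸ a) * (b ∸ a))                    ≡⟨ cong (λ n → fromℕ (n * n)) (ℕ.m≤n⇒∣m-n∣≡n∸m a≤b) ⟨
    fromℕ (ℕ.∣ a - b ∣ * ℕ.∣ a - b ∣)            ∎
    where
    -x*-y≈x*y : ∀ x y → (ℚ.- x) ℚ.* (ℚ.- y) ≡ x ℚ.* y
    -x*-y≈x*y x y = begin
      (ℚ.- x) ℚ.* (ℚ.- y)  ≡⟨ ℚ.neg-distribˡ-* x (ℚ.- y) ⟨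
      ℚ.- (x ℚ.* (ℚ.- y))  ≡⟨ cong ℚ.-_ (ℚ.neg-distribʳ-* x y) ⟨
      ℚ.- (ℚ.- (x ℚ.* y))  ≡⟨ ⁻¹-involutive (x ℚ.* y) ⟩
      x ℚ.* y              ∎

  -- The expansion of (a - b)², with the cross term moved across to avoid subtraction.
  square-distance : ∀ a b → ℕ.∣ a - b ∣ * ℕ.∣ a - b ∣ + a * (2 * b) ≡ a * a + b * b
  square-distance a b with ℕ.≤-total b a
  ... | inj₁ b≤a = begin
    ℕ.∣ a - b ∣ * ℕ.∣ a - b ∣ + a * (2 * b)      ≡⟨ cong (λ n → n * n + a * (2 * b)) (ℕ.m≤n⇒∣n-m∣≡n∸m b≤a) ⟩
    (a ∸ b) * (a ∸ b) + a * (2 * b)              ≡⟨ cong (λ n → (a ∸ b) * (a ∸ b) + n * (2 * b)) (ℕ.m+[n∸m]≡n b≤a) ⟨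
    (a ∸ b) * (a ∸ b) + (b + (a ∸ b)) * (2 * b)  ≡⟨ identity b (a ∸ b) ⟩
    (b + (a ∸ b)) * (b + (a ∸ b)) + b * b        ≡⟨ cong (λ n → n * n + b * b) (ℕ.m+[n∸m]≡n b≤a) ⟩
    a * a + b * b                                ∎
    where
    identity : ∀ b k → k * k + (b + k) * (2 * b) ≡ (b + k) * (b + k) + b * b
    identity = solve-∀
  ... | inj₂ a≤b = begin
    ℕ.∣ a - b ∣ * ℕ.∣ a - b ∣ + a * (2 * b)      ≡⟨ cong (λ n → n * n + a * (2 * b)) (ℕ.m≤n⇒∣m-n∣≡n∸m a≤b) ⟩
    (b ∸ a) * (b ∸ a) + a * (2 * b)              ≡⟨ cong (λ n → (b ∸ a) * (b ∸ a) + a * (2 * n)) (ℕ.m+[n∸m]≡n a≤b) ⟨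
    (b ∸ a) * (b ∸ a) + a * (2 * (a + (b ∸ a)))  ≡⟨ identity a (b ∸ a) ⟩
    a * a + (a + (b ∸ a)) * (a + (b ∸ a))        ≡⟨ cong (λ n → a * a + n * n) (ℕ.m+[n∸m]≡n a≤b) ⟩
    a * a + b * b                                ∎
    where
    identity : ∀ a k → k * k + a * (2 * (a + k)) ≡ a * a + (a + k) * (a + k)
    identity = solve-∀

  module _ (xs : List A) (f : A → ℕ) {n} .{{_ : NonZero n}} (length≡n : length xs ≡ n) {μ} (∑f : ∑ xs f ≡ n * μ) where

    𝔼-by-sum : 𝔼 xs (fromℕ ∘ f) ≡ fromℕ μ
    𝔼-by-sum = begin
      𝔼 xs (fromℕ ∘ f)              ≡⟨ 𝔼-fromℕ xs f length≡n ⟩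
      fromℕ (∑ xs f) ℚ.* (+ 1 / n)  ≡⟨ /-*-/ (∑ xs f) n 1 1 μ (trans (cong (_* 1) ∑f) (swap n μ)) ⟩
      (+ 1 / 1) ℚ.* fromℕ μ         ≡⟨ ℚ.*-identityˡ (fromℕ μ) ⟩
      fromℕ μ                       ∎
      where
      swap : ∀ n μ → n * μ * 1 ≡ 1 * μ * n
      swap = solve-∀

    -- The identity Var = 𝔼 f² - μ², multiplied by n and free of subtraction. The cross terms sum to
    -- 2 n μ², so one further n μ² is added on both sides and cancelled.
    ∑-distance : ∑ xs (λ x → ℕ.∣ f x - μ ∣ * ℕ.∣ f x - μ ∣) + n * (μ * μ) ≡ ∑ xs (λ x → f x * f x)
    ∑-distance = ℕ.+-cancelʳ-≡ (n * (μ * μ)) _ _ (begin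
      V + n * (μ * μ) + n * (μ * μ)                               ≡⟨ double V n μ ⟩
      V + n * μ * (2 * μ)                                         ≡⟨ cong (λ e → V + e * (2 * μ)) ∑f ⟨
      V + ∑ xs f * (2 * μ)                                        ≡⟨ cong₂ _+_ refl (∑-distribʳ-* xs f (2 * μ)) ⟨
      V + ∑ xs (λ x → f x * (2 * μ))                              ≡⟨ ∑-distrib-+ xs _ _ ⟨
      ∑ xs (λ x → ℕ.∣ f x - μ ∣ * ℕ.∣ f x - μ ∣ + f x * (2 * μ))  ≡⟨ ∑-cong xs (λ x → square-distance (f x) μ) ⟩
      ∑ xs (λ x → f x * f x + μ * μ)                              ≡⟨ ∑-distrib-+ xs _ _ ⟩
      ∑ xs (λ x → f x * f x) + ∑ xs (λ _ → μ * μ)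
        ≡⟨ cong₂ _+_ refl (trans (∑-const xs _) (cong (_* (μ * μ)) length≡n)) ⟩
      ∑ xs (λ x → f x * f x) + n * (μ * μ)  ∎)
      where
      V = ∑ xs (λ x → ℕ.∣ f x - μ ∣ * ℕ.∣ f x - μ ∣)
      double : ∀ V n μ → V + n * (μ * μ) + n * (μ * μ) ≡ V + n * μ * (2 * μ)
      double = solve-∀

    -- The hypothesis is 𝔼 f² = μ² + k c / d with denominators cleared; removing μ² leaves the
    -- variance.
    Var-by-sum : ∀ c d k .{{_ : NonZero d}} → d * ∑ xs (λ x → f x * f x) ≡ n * (μ * μ * d + k * c) →
      Var xs (fromℕ ∘ f) ≡ (+ c / d) ℚ.* fromℕ k
    Var-by-sum c d k ∑f² = begin
      Var xs (fromℕ ∘ f)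
        ≡⟨ cong (λ m → 𝔼 xs (λ x → (fromℕ (f x) ℚ.- m) ℚ.* (fromℕ (f x) ℚ.- m))) 𝔼-by-sum ⟩
      𝔼 xs (λ x → (fromℕ (f x) ℚ.- fromℕ μ) ℚ.* (fromℕ (f x) ℚ.- fromℕ μ))
        ≡⟨ cong mean (map-cong (λ x → square-sub (f x) μ) xs) ⟩
      𝔼 xs (λ x → fromℕ (ℕ.∣ f x - μ ∣ * ℕ.∣ f x - μ ∣))
        ≡⟨ 𝔼-fromℕ xs _ length≡n ⟩
      fromℕ V ℚ.* (+ 1 / n)
        ≡⟨ /-*-/ V n c d k scaled ⟩
      (+ c / d) ℚ.* fromℕ k ∎
      where
      V = ∑ xs (λ x → ℕ.∣ f x - μ ∣ * ℕ.∣ f x - μ ∣)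
      left : ∀ V d n μ → V * d + n * (μ * μ) * d ≡ d * (V + n * (μ * μ))
      left = solve-∀
      right : ∀ c d k n μ → n * (μ * μ * d + k * c) ≡ c * k * n + n * (μ * μ) * d
      right = solve-∀
      scaled : V * d ≡ c * k * n
      scaled = ℕ.+-cancelʳ-≡ (n * (μ * μ) * d) _ _ (begin
        V * d + n * (μ * μ) * d      ≡⟨ left V d n μ ⟩
        d * (V + n * (μ * μ))        ≡⟨ cong (d *_) ∑-distance ⟩
        d * ∑ xs (λ x → f x * f x)   ≡⟨ ∑f² ⟩
        n * (μ * μ * d + k * c)      ≡⟨ right c d k n μ ⟩
        c * k * n + n * (μ * μ) * d  ∎)

open import Data.Nat using (ℕ; _≤_; _+_; _∸_)
open import Data.Nat.Combinatorics using (_C_)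
open import Data.Integer using (+_)
open import Data.Rational using (ℚ; _/_; _*_)
open import Data.Product using (_×_)
open import Relation.Binary.PropositionalEquality using (_≡_)

theorem4 : (F : FiniteField) (m : ℕ) → 1 ≤ m →
  let open Poly F
      q = FiniteField.card F
      Φm = λ (s : Monic m) → (+ Φ s) / 1
  in (𝔼 (𝓜 m) Φm ≡ (+ (m + 1)) / 1)
     × (Var (𝓜 m) Φm ≡ ((+ (q ∸ 1)) / q) {{card-nonZero F}} * ((+ ((m + 1) C 3)) / 1))
theorem4 F m 1≤m = 𝔼-by-sum (𝓜 m) Φ (length-𝓜 m) ∑Φ , Var-by-sum (𝓜 m) Φ (length-𝓜 m) ∑Φ (q ∸ 1) q ((m + 1) C 3) ∑Φ²
  where
  open Poly F using (𝓜; Φ)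
  open Moments F using (length-𝓜; ∑-Φ; ∑-Φ²)
  q = FiniteField.card F
  instance
    q≢0 = card-nonZero F
    q^m≢0 = ℕ.m^n≢0 q m
  ∑Φ : ∑ (𝓜 m) Φ ≡ q ℕ.^ m ℕ.* (m + 1)
  ∑Φ = ≡.trans (∑-Φ m) (≡.cong (q ℕ.^ m ℕ.*_) (ℕ.+-comm 1 m))
  ∑Φ² : q ℕ.* ∑ (𝓜 m) (λ s → Φ s ℕ.* Φ s) ≡ q ℕ.^ m ℕ.* ((m + 1) ℕ.* (m + 1) ℕ.* q + ((m + 1) C 3) ℕ.* (q ∸ 1))
  ∑Φ² = ≡.trans (∑-Φ² m) (≡.cong₂ (λ n k → q ℕ.^ m ℕ.* (n ℕ.* n ℕ.* q + k ℕ.* (q ∸ 1))) (ℕ.+-comm 1 m)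
    (≡.trans (∑∑⊓≡C₃ m) (≡.cong (_C 3) (ℕ.+-comm 1 m))))
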